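{- For $N\ge1$ let $M_N$ be the $N\times N$ matrix with entries $$M_N(i,j)=\rho\bigl(x^i(1+x)^j\bigr)\,2^{ -\lfloor j/2\rfloor},\qquad 0\le i,j\le N-1 ,$$ where $\rho$ is the evaluation of palindromic polynomials defined in the context. Then for all $N\ge1$, $$\det M_N=2^{ -\binom N2}\,\ddot H_N\bigl((1+x)/\cos x\bigr) =\bigl((N-1)!!\bigr)^2\prod_{k=1}^{N-2}(k!!)^6 =\prod_{k=1}^{N-1}\bigl((N-k)!\bigr)^{\epsilon(k)},$$ where $\epsilon(k)=2$ for $k$ odd and $\epsilon(k)=4$ for $k$ even.
   Context: The index of a nonzero polynomial is its degree plus its valuation (the order of vanishing at $0$). A polynomial $P\in\mathbb Q[x]$ is palindromic of index $d$ if $x^dP(1/x)=P(x)$; e.g. $x^i(1+x)^j$ is palindromic of index $2i+j$. For $P$ palindromic of index $d$ put $$\mathscr N_0(P)=\frac{(x^{d}+1)\,P(1)-2P(x)}{(x-1)^2},$$ which is a polynomial, palindromic of index $d-2$ when nonzero (and $\mathscr N_0(0)=0$). Define $\rho(P)$ to be the constant term of $\mathscr N_0^{\lfloor d/2\rfloor}(P)$ (at each iteration $\mathscr N_0$ is formed with the current index); in particular $\rho(1)=1$ and $\rho(c(1+x))=c$. For a power series $f(x)=\sum_{k\ge0}a_kx^k/k!$, the dilated Hankel determinant is $\ddot H_N(f)=\det(a_{2i+j})_{0\le i,j\le N-1}$. Conventions: $m!!=m(m-2)(m-4)\cdots$ down to $1$ or $2$, with $0!!=(-1)!!=1$; empty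 products equal $1$. -}

module Defs where

open import Algebra.Bundles using (CommutativeRing)
open import Data.Bool.Base using (if_then_else_)
open import Data.Fin.Base using (Fin; zero; suc; toℕ)
open import Data.Integer.Base as ℤ using (ℤ; +_)
open import Data.List.Base using (List; []; _∷_; map; applyUpTo)
open import Data.List.Relation.Unary.All using (all?)
open import Data.Nat.Base as ℕ using (ℕ; zero; suc; _!; ⌊_/2⌋)
open import Data.Nat.GeneralisedArithmetic using (fold)
open import Data.Nat.ListAction using (product)
open import Data.Nat.Properties using (_!≢0)
open import Data.Rational.Base
  using (ℚ; 0ℚ; 1ℚ; _+_; _*_; _-_; -_; _/_; _÷_; ½; NonZero)
open import Data.Rational.Properties using (+-0-monoid; +-*-commutativeRing; _≟_)
open import Data.Vec.Base using (Vec; []; _∷_; head; lookup)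
open import Data.Vec.Functional using (Vector; removeAt)
open import Function.Base using (_∘_)
open import Relation.Nullary.Decidable using (⌊_⌋)

open import Algebra.Properties.Monoid.Sum +-0-monoid public using (sum)
open import Algebra.Properties.Semiring.Exp
  (CommutativeRing.semiring +-*-commutativeRing) public using (_^_)

fromℕ : ℕ → ℚ
fromℕ n = + n / 1

-- Polynomials over ℚ: a₀ ∷ a₁ ∷ … stands for a₀ + a₁ x + ⋯.  Trailing zeros
-- are allowed, so a polynomial has many representations; eval, constantTerm,
-- degree, valuation (hence index) of a nonzero polynomial, N₀ and ρ do not
-- depend (as polynomials, resp. numbers) on the one chosen.

Poly : Set
Poly = List ℚ

infixl 6 _+ᵖ_ _-ᵖ_
infixl 7 _*ᵖ_ _·ᵖ_
infixr 8 _^ᵖ_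

_+ᵖ_ : Poly → Poly → Poly
[]      +ᵖ q       = q
(a ∷ p) +ᵖ []      = a ∷ p
(a ∷ p) +ᵖ (b ∷ q) = (a + b) ∷ (p +ᵖ q)

_·ᵖ_ : ℚ → Poly → Poly
c ·ᵖ p = map (c *_) p

_-ᵖ_ : Poly → Poly → Poly
p -ᵖ q = p +ᵖ (- 1ℚ) ·ᵖ q

_*ᵖ_ : Poly → Poly → Poly
[]      *ᵖ q = []
(a ∷ p) *ᵖ q = a ·ᵖ q +ᵖ (0ℚ ∷ p *ᵖ q)

oneᵖ X : Poly
oneᵖ = 1ℚ ∷ []
X    = 0ℚ ∷ 1ℚ ∷ []

_^ᵖ_ : Poly → ℕ → Poly
p ^ᵖ zero  = oneᵖ
p ^ᵖ suc n = p *ᵖ p ^ᵖ n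

eval : Poly → ℚ → ℚ
eval []      c = 0ℚ
eval (a ∷ p) c = a + c * eval p c

constantTerm : Poly → ℚ
constantTerm []      = 0ℚ
constantTerm (a ∷ p) = a

-- degree, valuation and index are meaningful for nonzero polynomials only.

degree : Poly → ℕ
degree []      = 0
degree (a ∷ p) = if ⌊ all? (_≟ 0ℚ) p ⌋ then 0 else suc (degree p)

valuation : Poly → ℕ
valuation []      = 0
valuation (a ∷ p) = if ⌊ a ≟ 0ℚ ⌋ then suc (valuation p) else 0

index : Poly → ℕ
index p = degree p ℕ.+ valuation p

-- Synthetic division: P(x) = (x - c) · divLinear c P (x) + P(c).
divLinear : ℚ → Poly → Poly
divLinear c []      = []
divLinear c (a ∷ p) = eval p c ∷ divLinear c p

-- When P is palindromic of index d, 1 is a root of (x^d + 1) P(1) - 2 P(x) of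
-- multiplicity at least 2, so both divisions by x - 1 are exact.  N₀ sends
-- (every representation of) 0 to 0, whatever the value of index there.
N₀ : Poly → Poly
N₀ P = divLinear 1ℚ (divLinear 1ℚ
         (eval P 1ℚ ·ᵖ (X ^ᵖ index P +ᵖ oneᵖ) -ᵖ fromℕ 2 ·ᵖ P))

-- Only the values at palindromic P are meaningful.
ρ : Poly → ℚ
ρ P = constantTerm (fold P N₀ ⌊ index P /2⌋)

Matrix : ℕ → Set
Matrix n = Vector (Vector ℚ n) n

-- Laplace expansion along the first row.
det : ∀ {n} → Matrix n → ℚ
det {zero}  A = 1ℚ
det {suc n} A = sum λ j →
  (- 1ℚ) ^ toℕ j * A zero j * det (λ i → removeAt (A (suc i)) j)

M : ∀ N → Matrix N
M N i j = ρ (X ^ᵖ toℕ i *ᵖ (oneᵖ +ᵖ X) ^ᵖ toℕ j) * ½ ^ ⌊ toℕ j /2⌋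

-- Formal power series; f n is the coefficient of xⁿ (not of xⁿ/n!).
Series : Set
Series = ℕ → ℚ

-- The coefficients hₙ, …, h₀ (in this order) of h = f / g, determined by
--   fₙ = g₀ hₙ + g₁ hₙ₋₁ + ⋯ + gₙ h₀.
quotientCoeffs : (f g : Series) .{{_ : NonZero (g 0)}} → ∀ n → Vec ℚ (suc n)
quotientCoeffs f g zero    = (f 0 ÷ g 0) ∷ []
quotientCoeffs f g (suc n) =
  let h = quotientCoeffs f g n in
  ((f (suc n) - sum (λ k → g (suc (toℕ k)) * lookup h k)) ÷ g 0) ∷ h

infixl 7 _÷ˢ_

_÷ˢ_ : (f g : Series) .{{_ : NonZero (g 0)}} → Series
(f ÷ˢ g) n = head (quotientCoeffs f g n)

1+x : Series
1+x 0             = 1ℚ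
1+x 1             = 1ℚ
1+x (suc (suc _)) = 0ℚ

-- The n-th derivative of cos at 0.
cosDeriv : ℕ → ℤ
cosDeriv 0             = + 1
cosDeriv 1             = + 0
cosDeriv (suc (suc n)) = ℤ.- cosDeriv n

cos : Series
cos n = (cosDeriv n / n !) {{n !≢0}}

-- The aₙ in f = ∑ aₙ xⁿ / n!.
egfCoeff : Series → ℕ → ℚ
egfCoeff f n = fromℕ (n !) * f n

dilatedHankel : ℕ → Series → ℚ
dilatedHankel N f = det {N} λ i j → egfCoeff f (2 ℕ.* toℕ i ℕ.+ toℕ j)

infix 8 _!!

_!! : ℕ → ℕ
0           !! = 1
1           !! = 1
suc (suc n) !! = suc (suc n) ℕ.* n !!

-- ∏₁ n F = F 1 · F 2 ⋯ F n
∏₁ : ℕ → (ℕ → ℕ) → ℕ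
∏₁ n F = product (applyUpTo (F ∘ suc) n)

ε : ℕ → ℕ
ε 0             = 4
ε 1             = 2
ε (suc (suc k)) = ε k

module Submission where

-- Let F = (1 + x) / cos x and let D be the derivation, so that the i-th row of
-- the dilated Hankel matrix lists the derivatives of D²ⁱ F at 0.  With s = sec x
-- and t = tan x, the Legendre-type recurrence y (n+1) = (2n+1) t y n + n² y (n-1),
-- y 0 = 1 + x, y 1 = t y 0 + 1, produces series S n = s tⁿ y n that vanish to
-- order n at 0, start from S 0 = F and satisfy
--   D² S n = 2 (n+1) S (n+1) + a combination of S 0, …, S n.
-- So D²ⁱ F = 2ⁱ i! S i + (lower terms): an LU factorisation of the Hankel matrix.
--
-- The evaluation ρ kills 1 + x^d for d ≥ 2 and satisfies ρ((1-x)² Q) = - 2 ρ(Q).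
-- As (1 + x)² = (1 - x)² + 4x, the latter gives
--   M(i+1,j) = (M(i,j) + M(i,j+2)) / 2,
-- so M arises from the Hankel matrix of its first row by row operations with
-- pivots 2⁻ⁱ.  Applying ρ to
--   2ⁿ⁻¹ (1 + xⁿ) = ∑ₖ (n choose 2k) (1 + x)ⁿ⁻²ᵏ (1 - x)²ᵏ
-- shows that the exponential generating function of the first row, multiplied
-- by cos x, is 1 + x; hence that series is F.

open import Defs
open import Algebra.Bundles using (CommutativeRing)
import Algebra.Construct.Pointwise as Pointwise
open import Algebra.Structures using (IsCommutativeRing)
open import Data.Fin.Base using (Fin; zero; suc; toℕ; punchIn)
open import Data.Fin.Properties using (toℕ<n)
open import Data.Integer.Base as ℤ using (ℤ)
import Data.Integer.Properties as ℤ
open import Data.List.Base using ([]; _∷_; applyUpTo)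
open import Data.List.Relation.Unary.All using (All; []; _∷_; all?)
open import Data.Nat.Base as ℕ using (ℕ; zero; suc; s≤s; z≤n; _≤_; _∸_; _!; ⌊_/2⌋)
open import Data.Nat.Combinatorics using (_C_; nC1≡n; nCk+nC[k+1]≡[n+1]C[k+1])
open import Data.Nat.GeneralisedArithmetic using (fold)
open import Data.Nat.ListAction using (product)
import Data.Nat.Properties as ℕ
open import Data.Nat.Solver using (module +-*-Solver)
open import Data.Nat.Tactic.RingSolver using () renaming (solve-∀ to ℕ-solve-∀)
open import Data.Product.Base using (_×_; _,_)
open import Data.Rational.Base hiding (_≤_)
open import Data.Rational.Properties
open import Data.Rational.Unnormalised.Base as ℚᵘ using (mkℚᵘ; *≡*)
import Data.Rational.Unnormalised.Properties as ℚᵘ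
open import Data.Vec.Base using (lookup)
open import Data.Vec.Functional using (Vector; tail) renaming (_∷_ to _∷ᶠ_)
open import Function.Base using (_∘_)
open import Relation.Binary.PropositionalEquality hiding (setoid)
import Relation.Binary.Reasoning.Setoid as SetoidReasoning
open import Relation.Nullary using (¬_; yes; no; contradiction)
open import Relation.Nullary.Decidable using (dec⇒maybe)
open import Tactic.RingSolver using (solve-∀)
open import Tactic.RingSolver.Core.AlmostCommutativeRing using (AlmostCommutativeRing; fromCommutativeRing)

open import Algebra.Properties.Semiring.Exp (CommutativeRing.semiring +-*-commutativeRing) using (^-homo-*)
open import Algebra.Properties.Semiring.Sum (CommutativeRing.semiring +-*-commutativeRing)
  using (sum-cong-≗; ∑-distrib-+; *-distribˡ-sum)

-- The factor 2^(-⌊j/2⌋) is what makes the first row a sequence of derivatives of a known series: a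
-- factor (1 - x)² raises the index by 2 and multiplies ρ by -2, hence the normalised value by -1,
-- which is the rule of the derivatives of cos at 0. The double factorials come from tan 0 = 0. The
-- diagonal entry of the triangular factor is n! · y n (0), and at 0 the recurrence loses its term
-- in t, leaving y (n+1) (0) = n² · y (n-1) (0). On the polynomial side the obstacle is that ρ
-- recomputes the index at each step, so it is not visibly linear, and 0 has no meaningful index.
-- The evaluation `R d` takes the index as a parameter and acts linearly on all coefficient
-- sequences. It agrees with ρ on nonzero palindromic polynomials, because every step preserves
-- palindromicity.

ℚ-ring : AlmostCommutativeRing _ _
ℚ-ring = fromCommutativeRing +-*-commutativeRing (λ x → dec⇒maybe (0ℚ ≟ x))

-- Exponential generating functions as a differential ring

-- ∑ₖ (n choose k) · T k (n - k), by Pascal's rule.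
leibniz : (ℕ → ℕ → ℚ) → ℕ → ℚ
leibniz T zero    = T 0 0
leibniz T (suc n) = leibniz (λ p q → T (suc p) q) n + leibniz (λ p q → T p (suc q)) n

leibniz-cong : ∀ {T U} n → (∀ p q → T p q ≡ U p q) → leibniz T n ≡ leibniz U n
leibniz-cong zero    T≗U = T≗U 0 0
leibniz-cong (suc n) T≗U = cong₂ _+_
  (leibniz-cong n λ p q → T≗U (suc p) q) (leibniz-cong n λ p q → T≗U p (suc q))

leibniz-linear : ∀ a b T U n → leibniz (λ p q → a * T p q + b * U p q) n ≡ a * leibniz T n + b * leibniz U n
leibniz-linear a b T U zero    = refl
leibniz-linear a b T U (suc n) = trans
  (cong₂ _+_ (leibniz-linear a b _ _ n) (leibniz-linear a b _ _ n))
  (regroup a b _ _ _ _)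
  where
  regroup : ∀ a b x y u v → (a * x + b * y) + (a * u + b * v) ≡ a * (x + u) + b * (y + v)
  regroup = solve-∀ ℚ-ring

leibniz-+ : ∀ T U n → leibniz (λ p q → T p q + U p q) n ≡ leibniz T n + leibniz U n
leibniz-+ T U zero    = refl
leibniz-+ T U (suc n) = trans
  (cong₂ _+_ (leibniz-+ (λ p q → T (suc p) q) (λ p q → U (suc p) q) n)
             (leibniz-+ (λ p q → T p (suc q)) (λ p q → U p (suc q)) n))
  (regroup (leibniz (λ p q → T (suc p) q) n) _ _ _)
  where
  regroup : ∀ x y u v → (x + y) + (u + v) ≡ (x + u) + (y + v)
  regroup = solve-∀ ℚ-ring

leibniz-flip : ∀ T n → leibniz T n ≡ leibniz (λ p q → T q p) n
leibniz-flip T zero    = refl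
leibniz-flip T (suc n) = trans (+-comm (leibniz (λ p q → T (suc p) q) n) _)
  (cong₂ _+_ (leibniz-flip (λ p q → T p (suc q)) n) (leibniz-flip (λ p q → T (suc p) q) n))

leibniz-zero : ∀ n → leibniz (λ _ _ → 0ℚ) n ≡ 0ℚ
leibniz-zero zero    = refl
leibniz-zero (suc n) = cong₂ _+_ (leibniz-zero n) (leibniz-zero n)

infixl 6 _⊕_
infixl 7 _⊛_

-- `⊛` multiplies sequences of derivatives at 0. By the recursion of `leibniz`, `D (f ⊛ g)` unfolds
-- to `D f ⊛ g ⊕ f ⊛ D g`, so later proofs apply the product rule without citing it.
_⊕_ _⊛_ : Series → Series → Series
(f ⊕ g) n = f n + g n
(f ⊛ g) n = leibniz (λ p q → f p * g q) n

⊝_ : Series → Series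
(⊝ f) n = - f n

𝟘 𝟙 : Series
𝟘 n       = 0ℚ
𝟙 zero    = 1ℚ
𝟙 (suc n) = 0ℚ

D : Series → Series
D f n = f (suc n)

⊛-cong : ∀ {f f′ g g′} → f ≗ f′ → g ≗ g′ → f ⊛ g ≗ f′ ⊛ g′
⊛-cong f≗f′ g≗g′ n = leibniz-cong n λ p q → cong₂ _*_ (f≗f′ p) (g≗g′ q)

⊛-comm : ∀ f g → f ⊛ g ≗ g ⊛ f
⊛-comm f g n = trans (leibniz-flip (λ p q → f p * g q) n) (leibniz-cong n λ p q → *-comm (f q) (g p))

⊛-distribʳ : ∀ f g h → (g ⊕ h) ⊛ f ≗ (g ⊛ f) ⊕ (h ⊛ f)
⊛-distribʳ f g h n = trans
  (leibniz-cong n λ p q → *-distribʳ-+ (f q) (g p) (h p))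
  (leibniz-+ (λ p q → g p * f q) (λ p q → h p * f q) n)

⊛-distribˡ : ∀ f g h → f ⊛ (g ⊕ h) ≗ (f ⊛ g) ⊕ (f ⊛ h)
⊛-distribˡ f g h n = trans
  (leibniz-cong n λ p q → *-distribˡ-+ (f p) (g q) (h q))
  (leibniz-+ (λ p q → f p * g q) (λ p q → f p * h q) n)

-- Induction on `n` for all three series at once: the product rule leaves three products on each
-- side, one for each factor that is differentiated.
⊛-assoc : ∀ f g h → (f ⊛ g) ⊛ h ≗ f ⊛ (g ⊛ h)
⊛-assoc f g h zero    = *-assoc (f 0) (g 0) (h 0)
⊛-assoc f g h (suc n) = begin
  ((D f ⊛ g ⊕ f ⊛ D g) ⊛ h) n + ((f ⊛ g) ⊛ D h) n
    ≡⟨ cong (_+ ((f ⊛ g) ⊛ D h) n) (⊛-distribʳ h (D f ⊛ g) (f ⊛ D g) n) ⟩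
  ((D f ⊛ g) ⊛ h) n + ((f ⊛ D g) ⊛ h) n + ((f ⊛ g) ⊛ D h) n
    ≡⟨ cong₂ _+_ (cong₂ _+_ (⊛-assoc (D f) g h n) (⊛-assoc f (D g) h n)) (⊛-assoc f g (D h) n) ⟩
  (D f ⊛ (g ⊛ h)) n + (f ⊛ (D g ⊛ h)) n + (f ⊛ (g ⊛ D h)) n
    ≡⟨ +-assoc ((D f ⊛ (g ⊛ h)) n) _ _ ⟩
  (D f ⊛ (g ⊛ h)) n + ((f ⊛ (D g ⊛ h)) n + (f ⊛ (g ⊛ D h)) n)
    ≡⟨ cong ((D f ⊛ (g ⊛ h)) n +_) (⊛-distribˡ f (D g ⊛ h) (g ⊛ D h) n) ⟨
  (D f ⊛ (g ⊛ h)) n + (f ⊛ (D g ⊛ h ⊕ g ⊛ D h)) n ∎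
  where open ≡-Reasoning

-- Constants are the series killed by `D`. This is the passage from ring identities between series
-- to linear combinations with rational coefficients.
constant-⊛ : ∀ c → D c ≗ 𝟘 → ∀ f n → (c ⊛ f) n ≡ c 0 * f n
constant-⊛ c Dc≗0 f zero    = refl
constant-⊛ c Dc≗0 f (suc n) = begin
  (D c ⊛ f) n + (c ⊛ D f) n  ≡⟨ cong₂ _+_ (trans (leibniz-cong n λ p q → trans (cong (_* f q) (Dc≗0 p)) (*-zeroˡ (f q))) (leibniz-zero n)) (constant-⊛ c Dc≗0 (D f) n) ⟩
  0ℚ + c 0 * f (suc n)       ≡⟨ +-identityˡ _ ⟩
  c 0 * f (suc n)            ∎
  where open ≡-Reasoning

⊛-identityˡ : ∀ f → 𝟙 ⊛ f ≗ f
⊛-identityˡ f n = trans (constant-⊛ 𝟙 (λ _ → refl) f n) (*-identityˡ (f n))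

isCommutativeRing : IsCommutativeRing _≗_ _⊕_ _⊛_ ⊝_ 𝟘 𝟙
isCommutativeRing = record
  { isRing = record
    { +-isAbelianGroup = Pointwise.isAbelianGroup ℕ +-0-isAbelianGroup
    ; *-cong           = ⊛-cong
    ; *-assoc          = ⊛-assoc
    ; *-identity       = ⊛-identityˡ , λ f n → trans (⊛-comm f 𝟙 n) (⊛-identityˡ f n)
    ; distrib          = ⊛-distribˡ , ⊛-distribʳ
    }
  ; *-comm = ⊛-comm
  }

hurwitzRing : CommutativeRing _ _
hurwitzRing = record { isCommutativeRing = isCommutativeRing }

open CommutativeRing hurwitzRing using (commutativeSemiring; setoid; ring)
  renaming (sym to ≗-sym; trans to ≗-trans; +-cong to ⊕-cong; +-congˡ to ⊕-congˡ; +-congʳ to ⊕-congʳ;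
            *-congˡ to ⊛-congˡ; *-congʳ to ⊛-congʳ)
open import Algebra.Properties.Ring ring using (-‿distribˡ-*)
open import Algebra.Solver.Ring.NaturalCoefficients.Default commutativeSemiring
module ≗-Reasoning = SetoidReasoning setoid

-- The embedding of naturals and integers in ℚ

fromℚᵘ-homo-+ : ∀ p q → fromℚᵘ (p ℚᵘ.+ q) ≡ fromℚᵘ p + fromℚᵘ q
fromℚᵘ-homo-+ p q = toℚᵘ-injective (begin
  toℚᵘ (fromℚᵘ (p ℚᵘ.+ q))                 ≈⟨ toℚᵘ-fromℚᵘ (p ℚᵘ.+ q) ⟩
  p ℚᵘ.+ q                                 ≈⟨ ℚᵘ.+-cong (toℚᵘ-fromℚᵘ p) (toℚᵘ-fromℚᵘ q) ⟨
  toℚᵘ (fromℚᵘ p) ℚᵘ.+ toℚᵘ (fromℚᵘ q)     ≈⟨ toℚᵘ-homo-+ (fromℚᵘ p) (fromℚᵘ q) ⟨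
  toℚᵘ (fromℚᵘ p + fromℚᵘ q)               ∎)
  where open ℚᵘ.≃-Reasoning

fromℚᵘ-homo-* : ∀ p q → fromℚᵘ (p ℚᵘ.* q) ≡ fromℚᵘ p * fromℚᵘ q
fromℚᵘ-homo-* p q = toℚᵘ-injective (begin
  toℚᵘ (fromℚᵘ (p ℚᵘ.* q))                 ≈⟨ toℚᵘ-fromℚᵘ (p ℚᵘ.* q) ⟩
  p ℚᵘ.* q                                 ≈⟨ ℚᵘ.*-cong (toℚᵘ-fromℚᵘ p) (toℚᵘ-fromℚᵘ q) ⟨
  toℚᵘ (fromℚᵘ p) ℚᵘ.* toℚᵘ (fromℚᵘ q)     ≈⟨ toℚᵘ-homo-* (fromℚᵘ p) (fromℚᵘ q) ⟨
  toℚᵘ (fromℚᵘ p * fromℚᵘ q)               ∎)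
  where open ℚᵘ.≃-Reasoning

fromℕ-+ : ∀ m n → fromℕ (m ℕ.+ n) ≡ fromℕ m + fromℕ n
fromℕ-+ m n = trans
  (cong (_/ 1) (cong₂ ℤ._+_ (sym (ℤ.*-identityʳ (ℤ.+ m))) (sym (ℤ.*-identityʳ (ℤ.+ n)))))
  (fromℚᵘ-homo-+ (mkℚᵘ (ℤ.+ m) 0) (mkℚᵘ (ℤ.+ n) 0))

fromℕ-* : ∀ m n → fromℕ (m ℕ.* n) ≡ fromℕ m * fromℕ n
fromℕ-* m n = trans
  (cong (_/ 1) (ℤ.pos-* m n))
  (fromℚᵘ-homo-* (mkℚᵘ (ℤ.+ m) 0) (mkℚᵘ (ℤ.+ n) 0))

fromℕ-cancel : ∀ m (z : ℤ) .{{_ : ℕ.NonZero m}} → fromℕ m * (z / m) ≡ z / 1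
fromℕ-cancel (suc m) z = trans
  (sym (fromℚᵘ-homo-* (mkℚᵘ (ℤ.+ suc m) 0) (mkℚᵘ z m)))
  (fromℚᵘ-cong {mkℚᵘ (ℤ.+ suc m) 0 ℚᵘ.* mkℚᵘ z m} {mkℚᵘ z 0} (*≡* (trans (ℤ.*-identityʳ (ℤ.+ suc m ℤ.* z)) (trans (ℤ.*-comm (ℤ.+ suc m) z)
    (cong (λ u → z ℤ.* (ℤ.+ suc u)) (sym (ℕ.+-identityʳ m)))))))

neg-/1 : ∀ z → (ℤ.- z) / 1 ≡ - (z / 1)
neg-/1 (ℤ.+ zero)    = refl
neg-/1 (ℤ.+ suc n)   = refl
neg-/1 (ℤ.-[1+ n ]) = sym (neg-involutive _)
  where
  neg-involutive : ∀ x → - (- x) ≡ x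
  neg-involutive = solve-∀ ℚ-ring

-- Ordinary power series and their quotients

cauchy : Series → Series → Series
cauchy f g zero    = f 0 * g 0
cauchy f g (suc n) = f 0 * g (suc n) + cauchy (f ∘ suc) g n

cauchy-congˡ : ∀ {f f′} g → f ≗ f′ → cauchy f g ≗ cauchy f′ g
cauchy-congˡ g f≗f′ zero    = cong (_* g 0) (f≗f′ 0)
cauchy-congˡ g f≗f′ (suc n) = cong₂ (λ u v → u * g (suc n) + v) (f≗f′ 0) (cauchy-congˡ g (f≗f′ ∘ suc) n)

cauchy-+ˡ : ∀ f f′ g n → cauchy (f ⊕ f′) g n ≡ cauchy f g n + cauchy f′ g n
cauchy-+ˡ f f′ g zero    = *-distribʳ-+ (g 0) (f 0) (f′ 0)
cauchy-+ˡ f f′ g (suc n) = trans (cong ((f 0 + f′ 0) * g (suc n) +_) (cauchy-+ˡ (f ∘ suc) (f′ ∘ suc) g n))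
  (regroup (f 0) (f′ 0) (g (suc n)) (cauchy (f ∘ suc) g n) _)
  where
  regroup : ∀ a b c x y → (a + b) * c + (x + y) ≡ (a * c + x) + (b * c + y)
  regroup = solve-∀ ℚ-ring

-- The Euler operator x d/dx, a derivation of the Cauchy product. In ordinary coefficients d/dx is
-- `θ f ∘ suc`.
θ : Series → Series
θ f n = fromℕ n * f n

θ-cauchy : ∀ f g → θ (cauchy f g) ≗ cauchy (θ f) g ⊕ cauchy f (θ g)
θ-cauchy f g zero    = annihilate (f 0) (g 0)
  where
  annihilate : ∀ x y → 0ℚ * (x * y) ≡ 0ℚ * x * y + x * (0ℚ * y)
  annihilate = solve-∀ ℚ-ring
θ-cauchy f g (suc n) = begin
  fromℕ (suc n) * (f 0 * g (suc n) + cauchy f₊ g n)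
    ≡⟨ *-distribˡ-+ (fromℕ (suc n)) (f 0 * g (suc n)) (cauchy f₊ g n) ⟩
  fromℕ (suc n) * (f 0 * g (suc n)) + fromℕ (suc n) * cauchy f₊ g n
    ≡⟨ cong (λ u → fromℕ (suc n) * (f 0 * g (suc n)) + u * cauchy f₊ g n) (fromℕ-+ 1 n) ⟩
  fromℕ (suc n) * (f 0 * g (suc n)) + (1ℚ + fromℕ n) * cauchy f₊ g n
    ≡⟨ regroup₁ (fromℕ (suc n)) (f 0) (g (suc n)) (fromℕ n) (cauchy f₊ g n) ⟩
  f 0 * (fromℕ (suc n) * g (suc n)) + (cauchy f₊ g n + fromℕ n * cauchy f₊ g n)
    ≡⟨ cong (λ u → f 0 * (fromℕ (suc n) * g (suc n)) + (cauchy f₊ g n + u)) (θ-cauchy f₊ g n) ⟩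
  f 0 * (fromℕ (suc n) * g (suc n)) + (cauchy f₊ g n + (cauchy (θ f₊) g n + cauchy f₊ (θ g) n))
    ≡⟨ regroup₂ (f 0) (fromℕ (suc n)) (g (suc n)) (cauchy f₊ g n) (cauchy (θ f₊) g n) (cauchy f₊ (θ g) n) ⟩
  0ℚ * f 0 * g (suc n) + (cauchy f₊ g n + cauchy (θ f₊) g n) + (f 0 * (fromℕ (suc n) * g (suc n)) + cauchy f₊ (θ g) n)
    ≡⟨ cong (λ u → 0ℚ * f 0 * g (suc n) + u + (f 0 * (fromℕ (suc n) * g (suc n)) + cauchy f₊ (θ g) n))
         (trans (sym (cauchy-+ˡ f₊ (θ f₊) g n)) (cauchy-congˡ g (λ k → sym (θ-suc k)) n)) ⟩
  0ℚ * f 0 * g (suc n) + cauchy (θ f ∘ suc) g n + (f 0 * (fromℕ (suc n) * g (suc n)) + cauchy f₊ (θ g) n) ∎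
  where
  open ≡-Reasoning
  f₊ : Series
  f₊ = f ∘ suc
  θ-suc : θ f ∘ suc ≗ f₊ ⊕ θ f₊
  θ-suc k = trans (cong (_* f (suc k)) (fromℕ-+ 1 k)) (expand (fromℕ k) (f (suc k)))
    where
    expand : ∀ k x → (1ℚ + k) * x ≡ x + k * x
    expand = solve-∀ ℚ-ring
  regroup₁ : ∀ a x y k c → a * (x * y) + (1ℚ + k) * c ≡ x * (a * y) + (c + k * c)
  regroup₁ = solve-∀ ℚ-ring
  regroup₂ : ∀ x a y c u v → x * (a * y) + (c + (u + v)) ≡ 0ℚ * x * y + (c + u) + (x * (a * y) + v)
  regroup₂ = solve-∀ ℚ-ring

cauchy-sucʳ : ∀ f g → g 0 ≡ 0ℚ → ∀ n → cauchy f g (suc n) ≡ cauchy f (g ∘ suc) n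
cauchy-sucʳ f g g₀ zero    = trans (cong (λ u → f 0 * g 1 + f 1 * u) g₀) (simplify (f 0 * g 1) (f 1))
  where
  simplify : ∀ x y → x + y * 0ℚ ≡ x
  simplify = solve-∀ ℚ-ring
cauchy-sucʳ f g g₀ (suc n) = cong (f 0 * g (suc (suc n)) +_) (cauchy-sucʳ (f ∘ suc) g g₀ n)

D-egfCoeff : ∀ f → D (egfCoeff f) ≗ egfCoeff (θ f ∘ suc)
D-egfCoeff f n = trans (cong (_* f (suc n)) (fromℕ-* (suc n) (n !))) (swap (fromℕ (suc n)) (fromℕ (n !)) (f (suc n)))
  where
  swap : ∀ a b x → a * b * x ≡ b * (a * x)
  swap = solve-∀ ℚ-ring

-- Induction on `n` by the product rule on both sides, so that no quotient of factorials has to be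
-- compared with a binomial coefficient.
egfCoeff-cauchy : ∀ f g → egfCoeff (cauchy f g) ≗ egfCoeff f ⊛ egfCoeff g
egfCoeff-cauchy f g zero    = units (f 0) (g 0)
  where
  units : ∀ x y → 1ℚ * (x * y) ≡ 1ℚ * x * (1ℚ * y)
  units = solve-∀ ℚ-ring
egfCoeff-cauchy f g (suc n) = begin
  egfCoeff (cauchy f g) (suc n)
    ≡⟨ D-egfCoeff (cauchy f g) n ⟩
  fromℕ (n !) * θ (cauchy f g) (suc n)
    -- Both `θ f` and `θ g` vanish at 0, so either product can be shifted by one, which turns θ into
    -- d/dx.
    ≡⟨ cong (fromℕ (n !) *_) (trans (θ-cauchy f g (suc n)) (cong₂ _+_ θfg (cauchy-sucʳ f (θ g) (*-zeroˡ (g 0)) n))) ⟩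
  fromℕ (n !) * (cauchy (θ f ∘ suc) g n + cauchy f (θ g ∘ suc) n)
    ≡⟨ *-distribˡ-+ (fromℕ (n !)) (cauchy (θ f ∘ suc) g n) (cauchy f (θ g ∘ suc) n) ⟩
  egfCoeff (cauchy (θ f ∘ suc) g) n + egfCoeff (cauchy f (θ g ∘ suc)) n
    ≡⟨ cong₂ _+_ (egfCoeff-cauchy (θ f ∘ suc) g n) (egfCoeff-cauchy f (θ g ∘ suc) n) ⟩
  (egfCoeff (θ f ∘ suc) ⊛ egfCoeff g) n + (egfCoeff f ⊛ egfCoeff (θ g ∘ suc)) n
    ≡⟨ cong₂ _+_ (⊛-congʳ {egfCoeff g} (D-egfCoeff f) n) (⊛-congˡ {egfCoeff f} (D-egfCoeff g) n) ⟨
  (D (egfCoeff f) ⊛ egfCoeff g) n + (egfCoeff f ⊛ D (egfCoeff g)) n ∎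
  where
  open ≡-Reasoning
  θfg : cauchy (θ f) g (suc n) ≡ cauchy (θ f ∘ suc) g n
  θfg = dropZero (f 0) (g (suc n)) (cauchy (θ f ∘ suc) g n)
    where
    dropZero : ∀ x y c → 0ℚ * x * y + c ≡ c
    dropZero = solve-∀ ℚ-ring

-- The vector holds hₙ, ..., h₀ in this order, so pairing it with p₀, p₁, ... is already a
-- convolution.
lookup-quotientCoeffs : ∀ f g .{{_ : NonZero (g 0)}} (p : Series) n →
  sum (λ k → p (toℕ k) * lookup (quotientCoeffs f g n) k) ≡ cauchy p (f ÷ˢ g) n
lookup-quotientCoeffs f g p zero    = +-identityʳ _
lookup-quotientCoeffs f g p (suc n) = cong (p 0 * (f ÷ˢ g) (suc n) +_) (lookup-quotientCoeffs f g (p ∘ suc) n)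

*-÷-cancel : ∀ a x .{{_ : NonZero a}} → a * (x ÷ a) ≡ x
*-÷-cancel a x = trans (rearrange a x (1/ a)) (trans (cong (x *_) (*-inverseʳ a)) (*-identityʳ x))
  where
  rearrange : ∀ a x b → a * (x * b) ≡ x * (a * b)
  rearrange = solve-∀ ℚ-ring

cauchy-÷ˢ : ∀ f g .{{_ : NonZero (g 0)}} → cauchy g (f ÷ˢ g) ≗ f
cauchy-÷ˢ f g zero    = *-÷-cancel (g 0) (f 0)
cauchy-÷ˢ f g (suc n) = trans
  (cong₂ _+_ (*-÷-cancel (g 0) (f (suc n) - sum (λ k → g (suc (toℕ k)) * lookup (quotientCoeffs f g n) k))) (sym (lookup-quotientCoeffs f g (g ∘ suc) n)))
  (cancel (f (suc n)) (sum (λ k → g (suc (toℕ k)) * lookup (quotientCoeffs f g n) k)))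
  where
  cancel : ∀ x y → x - y + y ≡ x
  cancel = solve-∀ ℚ-ring

egfCoeff-÷ˢ : ∀ f g .{{_ : NonZero (g 0)}} → egfCoeff g ⊛ egfCoeff (f ÷ˢ g) ≗ egfCoeff f
egfCoeff-÷ˢ f g n = trans (sym (egfCoeff-cauchy g (f ÷ˢ g) n)) (cong (fromℕ (n !) *_) (cauchy-÷ˢ f g n))

-- The series of cos, sec, tan and (1 + x) / cos x

cosᴴ : Series
cosᴴ n = cosDeriv n / 1

egfCoeff-cos : egfCoeff cos ≗ cosᴴ
egfCoeff-cos n = fromℕ-cancel (n !) (cosDeriv n) {{n ℕ.!≢0}}

egfCoeff-1+x : egfCoeff 1+x ≗ 1+x
egfCoeff-1+x zero          = refl
egfCoeff-1+x (suc zero)    = refl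
egfCoeff-1+x (suc (suc n)) = *-zeroʳ (fromℕ (suc (suc n) !))

secᴴ sinᴴ tanᴴ F : Series
secᴴ = egfCoeff (𝟙 ÷ˢ cos)
sinᴴ = ⊝ D cosᴴ
tanᴴ = sinᴴ ⊛ secᴴ
F   = egfCoeff (1+x ÷ˢ cos)

egfCoeff-𝟙 : egfCoeff 𝟙 ≗ 𝟙
egfCoeff-𝟙 zero    = refl
egfCoeff-𝟙 (suc n) = *-zeroʳ (fromℕ (suc n !))

cosᴴ⊛secᴴ : cosᴴ ⊛ secᴴ ≗ 𝟙
cosᴴ⊛secᴴ = ≗-trans (⊛-congʳ {secᴴ} (≗-sym egfCoeff-cos)) (≗-trans (egfCoeff-÷ˢ 𝟙 cos) egfCoeff-𝟙)

cosᴴ⊛F : cosᴴ ⊛ F ≗ 1+x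
cosᴴ⊛F = ≗-trans (⊛-congʳ {F} (≗-sym egfCoeff-cos)) (≗-trans (egfCoeff-÷ˢ 1+x cos) egfCoeff-1+x)

divide-cosᴴ : ∀ {f g} → cosᴴ ⊛ f ≗ g → f ≗ secᴴ ⊛ g
divide-cosᴴ {f} {g} Cf≗g = begin
  f               ≈⟨ ⊛-identityˡ f ⟨
  𝟙 ⊛ f           ≈⟨ ⊛-congʳ {f} cosᴴ⊛secᴴ ⟨
  cosᴴ ⊛ secᴴ ⊛ f     ≈⟨ ⊛-congʳ {f} (⊛-comm cosᴴ secᴴ) ⟩
  secᴴ ⊛ cosᴴ ⊛ f     ≈⟨ ⊛-assoc secᴴ cosᴴ f ⟩
  secᴴ ⊛ (cosᴴ ⊛ f)   ≈⟨ ⊛-congˡ {secᴴ} Cf≗g ⟩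
  secᴴ ⊛ g         ∎
  where open ≗-Reasoning

D-sinᴴ : D sinᴴ ≗ cosᴴ
D-sinᴴ n = trans (cong -_ (neg-/1 (cosDeriv n))) (neg-involutive (cosᴴ n))
  where
  neg-involutive : ∀ x → - (- x) ≡ x
  neg-involutive = solve-∀ ℚ-ring

D-secᴴ : D secᴴ ≗ secᴴ ⊛ tanᴴ
D-secᴴ = divide-cosᴴ λ n → begin
  (cosᴴ ⊛ D secᴴ) n                                 ≡⟨ cancel ((cosᴴ ⊛ D secᴴ) n) ((D cosᴴ ⊛ secᴴ) n) ⟩
  -- The equation cos · sec = 1 at index `suc n` is its derivative at index `n`.
  (D cosᴴ ⊛ secᴴ) n + (cosᴴ ⊛ D secᴴ) n - (D cosᴴ ⊛ secᴴ) n ≡⟨ cong (_- (D cosᴴ ⊛ secᴴ) n) (cosᴴ⊛secᴴ (suc n)) ⟩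
  0ℚ - (D cosᴴ ⊛ secᴴ) n                            ≡⟨ +-identityˡ _ ⟩
  - (D cosᴴ ⊛ secᴴ) n                               ≡⟨ -‿distribˡ-* (D cosᴴ) secᴴ n ⟩
  (sinᴴ ⊛ secᴴ) n                                 ∎
  where
  open ≡-Reasoning
  cancel : ∀ x y → x ≡ y + x - y
  cancel = solve-∀ ℚ-ring

D-tanᴴ : D tanᴴ ≗ 𝟙 ⊕ tanᴴ ⊛ tanᴴ
D-tanᴴ = ⊕-cong (≗-trans (⊛-congʳ {secᴴ} D-sinᴴ) cosᴴ⊛secᴴ)
  (≗-trans (⊛-congˡ {sinᴴ} D-secᴴ) (≗-sym (⊛-assoc sinᴴ secᴴ tanᴴ)))

D-1+x : D 1+x ≗ 𝟙
D-1+x zero    = refl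
D-1+x (suc n) = refl

-- Legendre functions at an imaginary argument

infixr 8 _↑_

_↑_ : Series → ℕ → Series
f ↑ zero  = 𝟙
f ↑ suc n = f ⊛ f ↑ n

-- The integer n inside the series ring, where the solver can treat it as an atom and `ν (suc n)` as
-- one more than it.
ν : ℕ → Series
ν zero    = 𝟘
ν (suc n) = 𝟙 ⊕ ν n

Dν : ∀ n → D (ν n) ≗ 𝟘
Dν zero    j = refl
Dν (suc n) j = trans (+-identityˡ (D (ν n) j)) (Dν n j)

ν-⊛ : ∀ n f → ν n ⊛ f ≗ λ j → ν n 0 * f j
ν-⊛ n = constant-⊛ (ν n) (Dν n)

D-constant⊛ : ∀ c → D c ≗ 𝟘 → ∀ f → D (c ⊛ f) ≗ c ⊛ D f
D-constant⊛ c Dc≗𝟘 f j = trans (constant-⊛ c Dc≗𝟘 f (suc j)) (sym (constant-⊛ c Dc≗𝟘 (D f) j))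

D-ν⊛ : ∀ n f → D (ν n ⊛ f) ≗ ν n ⊛ D f
D-ν⊛ n = D-constant⊛ (ν n) (Dν n)

D-⊕ : ∀ f g → D f ≗ 𝟘 → D g ≗ 𝟘 → D (f ⊕ g) ≗ 𝟘
D-⊕ f g Df≗𝟘 Dg≗𝟘 j = cong₂ _+_ (Df≗𝟘 j) (Dg≗𝟘 j)

D-⊛ : ∀ f g → D f ≗ 𝟘 → D g ≗ 𝟘 → D (f ⊛ g) ≗ 𝟘
D-⊛ f g Df≗𝟘 Dg≗𝟘 j = trans (D-constant⊛ f Df≗𝟘 g j)
  (trans (constant-⊛ f Df≗𝟘 (D g) j) (trans (cong (f 0 *_) (Dg≗𝟘 j)) (*-zeroʳ (f 0))))

D-cong : ∀ {f g} → f ≗ g → D f ≗ D g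
D-cong f≗g j = f≗g (suc j)

-- In the application s = sec, t = tan and l = 1 + x.  The series y n satisfy
-- the recurrence and the derivative formula of the (rescaled) Legendre
-- functions at the imaginary argument i · tan.
module LegendreTower (s t l : Series) (Ds : D s ≗ s ⊛ t) (Dt : D t ≗ 𝟙 ⊕ t ⊛ t) (Dl : D l ≗ 𝟙) where

  -- w n = n² · y (n - 1), except that w 0 = 1.
  y w : ℕ → Series
  y zero    = l
  y (suc n) = (𝟙 ⊕ ν n ⊕ ν n) ⊛ t ⊛ y n ⊕ w n
  w zero    = 𝟙
  w (suc n) = ν (suc n) ⊛ ν (suc n) ⊛ y n

  -- Lowering and raising relations, by mutual induction. `D-w` at `suc n` is D (y n) = y (n+1) -
  -- (n+1) t (y n) multiplied by (n+1)²; the negative term stands on the left because the solver has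
  -- natural coefficients only.
  D-y : ∀ n → D (y n) ≗ ν n ⊛ t ⊛ y n ⊕ w n
  D-w : ∀ n → D (w n) ⊕ ν n ⊛ t ⊛ w n ≗ ν n ⊛ ν n ⊛ y n

  D-y zero    = ≗-trans Dl (solve 2 (λ t l → con 1 := con 0 :* t :* l :+ con 1) (λ _ → refl) t l)
  D-y (suc n) = begin
    D (c ⊛ t) ⊛ y n ⊕ c ⊛ t ⊛ D (y n) ⊕ D (w n)
      ≈⟨ ⊕-congʳ (⊕-cong (⊛-congʳ {y n} (≗-trans (D-constant⊛ c Dc t) (⊛-congˡ {c} Dt))) (⊛-congˡ {c ⊛ t} (D-y n))) ⟩
    c ⊛ (𝟙 ⊕ t ⊛ t) ⊛ y n ⊕ c ⊛ t ⊛ (ν n ⊛ t ⊛ y n ⊕ w n) ⊕ D (w n)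
      -- Grouped so that the left-hand side of `D-w n` appears.
      ≈⟨ solve 5 (λ n t y w w′ → let c = con 1 :+ n :+ n in
           c :* (con 1 :+ t :* t) :* y :+ c :* t :* (n :* t :* y :+ w) :+ w′ :=
           (w′ :+ n :* t :* w) :+ (c :* (con 1 :+ n) :* t :* t :* y :+ c :* y :+ (con 1 :+ n) :* t :* w)) (λ _ → refl) (ν n) t (y n) (w n) (D (w n)) ⟩
    (D (w n) ⊕ ν n ⊛ t ⊛ w n) ⊕ (c ⊛ (𝟙 ⊕ ν n) ⊛ t ⊛ t ⊛ y n ⊕ c ⊛ y n ⊕ (𝟙 ⊕ ν n) ⊛ t ⊛ w n)
      ≈⟨ ⊕-congʳ (D-w n) ⟩
    ν n ⊛ ν n ⊛ y n ⊕ (c ⊛ (𝟙 ⊕ ν n) ⊛ t ⊛ t ⊛ y n ⊕ c ⊛ y n ⊕ (𝟙 ⊕ ν n) ⊛ t ⊛ w n)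
      ≈⟨ solve 4 (λ n t y w → let c = con 1 :+ n :+ n in
           n :* n :* y :+ (c :* (con 1 :+ n) :* t :* t :* y :+ c :* y :+ (con 1 :+ n) :* t :* w) :=
           (con 1 :+ n) :* t :* (c :* t :* y :+ w) :+ (con 1 :+ n) :* (con 1 :+ n) :* y) (λ _ → refl) (ν n) t (y n) (w n) ⟩
    ν (suc n) ⊛ t ⊛ y (suc n) ⊕ w (suc n) ∎
    where
    open ≗-Reasoning
    c : Series
    c = 𝟙 ⊕ ν n ⊕ ν n
    Dc : D c ≗ 𝟘
    Dc j = cong₂ (λ u v → 0ℚ + u + v) (Dν n j) (Dν n j)

  D-w zero    = solve 2 (λ t y → con 0 :+ con 0 :* t :* con 1 := con 0 :* con 0 :* y) (λ _ → refl) t (y 0)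
  D-w (suc n) = begin
    D (k ⊛ k ⊛ y n) ⊕ k ⊛ t ⊛ (k ⊛ k ⊛ y n)
      ≈⟨ ⊕-congʳ (≗-trans (D-constant⊛ (k ⊛ k) D-kk (y n)) (⊛-congˡ {k ⊛ k} (D-y n))) ⟩
    k ⊛ k ⊛ (ν n ⊛ t ⊛ y n ⊕ w n) ⊕ k ⊛ t ⊛ (k ⊛ k ⊛ y n)
      ≈⟨ solve 4 (λ n t y w → let k = con 1 :+ n in
           k :* k :* (n :* t :* y :+ w) :+ k :* t :* (k :* k :* y) :=
           k :* k :* ((con 1 :+ n :+ n) :* t :* y :+ w)) (λ _ → refl) (ν n) t (y n) (w n) ⟩
    k ⊛ k ⊛ y (suc n) ∎
    where
    open ≗-Reasoning
    k : Series
    k = ν (suc n)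
    D-kk : D (k ⊛ k) ≗ 𝟘
    D-kk j = trans (D-ν⊛ (suc n) k j) (trans (ν-⊛ (suc n) (D k) j) (trans (cong (k 0 *_) (Dν (suc n) j)) (*-zeroʳ (k 0))))

  D-↑ : ∀ n → D (t ↑ suc n) ≗ ν (suc n) ⊛ (𝟙 ⊕ t ⊛ t) ⊛ t ↑ n
  D-↑ zero    = begin
    D t ⊛ 𝟙 ⊕ t ⊛ D 𝟙
      ≈⟨ ⊕-cong (⊛-congʳ {𝟙} Dt) (⊛-congˡ {t} (λ _ → refl)) ⟩
    (𝟙 ⊕ t ⊛ t) ⊛ 𝟙 ⊕ t ⊛ 𝟘
      ≈⟨ solve 1 (λ t → (con 1 :+ t :* t) :* con 1 :+ t :* con 0 := (con 1 :+ con 0) :* (con 1 :+ t :* t) :* con 1) (λ _ → refl) t ⟩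
    ν 1 ⊛ (𝟙 ⊕ t ⊛ t) ⊛ 𝟙 ∎
    where open ≗-Reasoning
  D-↑ (suc n) = begin
    D t ⊛ t ↑ suc n ⊕ t ⊛ D (t ↑ suc n)
      ≈⟨ ⊕-cong (⊛-congʳ {t ↑ suc n} Dt) (⊛-congˡ {t} (D-↑ n)) ⟩
    (𝟙 ⊕ t ⊛ t) ⊛ (t ⊛ t ↑ n) ⊕ t ⊛ (ν (suc n) ⊛ (𝟙 ⊕ t ⊛ t) ⊛ t ↑ n)
      ≈⟨ solve 3 (λ k t u → (con 1 :+ t :* t) :* (t :* u) :+ t :* (k :* (con 1 :+ t :* t) :* u) :=
           (con 1 :+ k) :* (con 1 :+ t :* t) :* (t :* u)) (λ _ → refl) (ν (suc n)) t (t ↑ n) ⟩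
    ν (suc (suc n)) ⊛ (𝟙 ⊕ t ⊛ t) ⊛ t ↑ suc n ∎
    where open ≗-Reasoning

  -- `Z` is a half-way station: one derivative takes the `S` to combinations of the `Z`, and a
  -- second brings these back. Hence the square of `D` acts on the span of the `S`, as the dilated
  -- rows require.
  S Z : ℕ → Series
  S n = s ⊛ (t ↑ n ⊛ y n)
  Z n = s ⊛ (t ↑ n ⊛ y (suc n))

  D-s⊛ : ∀ f → D (s ⊛ f) ≗ s ⊛ t ⊛ f ⊕ s ⊛ D f
  D-s⊛ f = ⊕-congʳ (⊛-congʳ {f} Ds)

  D-s⊛↑⊛ : ∀ n f → D (s ⊛ (t ↑ suc n ⊛ f)) ≗
    s ⊛ t ⊛ (t ↑ suc n ⊛ f) ⊕ s ⊛ (ν (suc n) ⊛ (𝟙 ⊕ t ⊛ t) ⊛ t ↑ n ⊛ f ⊕ t ↑ suc n ⊛ D f)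
  D-s⊛↑⊛ n f = ≗-trans (D-s⊛ (t ↑ suc n ⊛ f))
    (⊕-congˡ {s ⊛ t ⊛ (t ↑ suc n ⊛ f)} (⊛-congˡ {s} (⊕-congʳ {t ↑ suc n ⊛ D f} (⊛-congʳ {f} (D-↑ n)))))

  D-s⊛𝟙⊛ : ∀ f → D (s ⊛ (𝟙 ⊛ f)) ≗ s ⊛ t ⊛ f ⊕ s ⊛ D f
  D-s⊛𝟙⊛ f = ≗-trans (D-cong (⊛-cong {s} (λ _ → refl) (⊛-identityˡ f))) (D-s⊛ f)

  D-S₀ : D (S 0) ≗ Z 0
  D-S₀ = begin
    D (S 0)
      ≈⟨ D-s⊛𝟙⊛ l ⟩
    s ⊛ t ⊛ l ⊕ s ⊛ D l
      ≈⟨ ⊕-congˡ {s ⊛ t ⊛ l} (⊛-congˡ {s} Dl) ⟩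
    s ⊛ t ⊛ l ⊕ s ⊛ 𝟙
      ≈⟨ solve 3 (λ s t l → s :* t :* l :+ s :* con 1 := s :* (con 1 :* ((con 1 :+ con 0 :+ con 0) :* t :* l :+ con 1))) (λ _ → refl) s t l ⟩
    Z 0 ∎
    where open ≗-Reasoning

  -- With k = n+1, the coefficient 2k+1 of the recurrence is the sum of 1 from `D s`, k from the
  -- power of t and k from `D-y`, so these terms form y (k+1). The 1 in `D t` leaves the term in
  -- `Z n`.
  D-S₊ : ∀ n → D (S (suc n)) ≗ Z (suc n) ⊕ ν (suc n) ⊛ Z n
  D-S₊ n = begin
    D (S (suc n))
      ≈⟨ D-s⊛↑⊛ n (y (suc n)) ⟩
    s ⊛ t ⊛ (t ⊛ t ↑ n ⊛ y (suc n)) ⊕ s ⊛ (k ⊛ (𝟙 ⊕ t ⊛ t) ⊛ t ↑ n ⊛ y (suc n) ⊕ t ⊛ t ↑ n ⊛ D (y (suc n)))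
      ≈⟨ ⊕-congˡ {s ⊛ t ⊛ (t ⊛ t ↑ n ⊛ y (suc n))} (⊛-congˡ {s} (⊕-congˡ {k ⊛ (𝟙 ⊕ t ⊛ t) ⊛ t ↑ n ⊛ y (suc n)} (⊛-congˡ {t ⊛ t ↑ n} (D-y (suc n))))) ⟩
    s ⊛ t ⊛ (t ⊛ t ↑ n ⊛ y (suc n)) ⊕ s ⊛ (k ⊛ (𝟙 ⊕ t ⊛ t) ⊛ t ↑ n ⊛ y (suc n) ⊕ t ⊛ t ↑ n ⊛ (k ⊛ t ⊛ y (suc n) ⊕ w (suc n)))
      ≈⟨ solve 6 (λ s t k u y w →
           s :* t :* (t :* u :* y) :+ s :* (k :* (con 1 :+ t :* t) :* u :* y :+ t :* u :* (k :* t :* y :+ w)) :=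
           s :* (t :* u :* ((con 1 :+ k :+ k) :* t :* y :+ w)) :+ k :* (s :* (u :* y))) (λ _ → refl) s t k (t ↑ n) (y (suc n)) (w (suc n)) ⟩
    Z (suc n) ⊕ k ⊛ Z n ∎
    where
    open ≗-Reasoning
    k : Series
    k = ν (suc n)

  D-Z₀ : D (Z 0) ≗ (ν 1 ⊕ ν 1) ⊛ S 1 ⊕ S 0
  D-Z₀ = begin
    D (Z 0)
      ≈⟨ D-s⊛𝟙⊛ (y 1) ⟩
    s ⊛ t ⊛ y 1 ⊕ s ⊛ D (y 1)
      ≈⟨ ⊕-congˡ {s ⊛ t ⊛ y 1} (⊛-congˡ {s} (D-y 1)) ⟩
    s ⊛ t ⊛ y 1 ⊕ s ⊛ (ν 1 ⊛ t ⊛ y 1 ⊕ ν 1 ⊛ ν 1 ⊛ l)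
      ≈⟨ solve 4 (λ s t y l → let one = con 1 :+ con 0 in
           s :* t :* y :+ s :* (one :* t :* y :+ one :* one :* l) :=
           (one :+ one) :* (s :* (t :* con 1 :* y)) :+ s :* (con 1 :* l)) (λ _ → refl) s t (y 1) l ⟩
    (ν 1 ⊕ ν 1) ⊛ S 1 ⊕ S 0 ∎
    where open ≗-Reasoning

  -- The coefficient 2(n+2) collects 1 from `D s`, n+1 from the power of t and n+2 from `D-y`. The 1
  -- in `D t` leaves a multiple of s tⁿ y (n+2), which the recurrence expands into multiples of
  -- `S (suc n)` and `S n`.
  D-Z₊ : ∀ n → let k = ν (suc n) in
    D (Z (suc n)) ≗ (ν (suc (suc n)) ⊕ ν (suc (suc n))) ⊛ S (suc (suc n)) ⊕
      (((𝟙 ⊕ k) ⊛ (𝟙 ⊕ k) ⊕ k ⊛ (𝟙 ⊕ k ⊕ k)) ⊛ S (suc n) ⊕ k ⊛ k ⊛ k ⊛ S n)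
  D-Z₊ n = begin
    D (Z (suc n))
      ≈⟨ D-s⊛↑⊛ n y₂ ⟩
    s ⊛ t ⊛ (t ⊛ t ↑ n ⊛ y₂) ⊕ s ⊛ (k ⊛ (𝟙 ⊕ t ⊛ t) ⊛ t ↑ n ⊛ y₂ ⊕ t ⊛ t ↑ n ⊛ D y₂)
      ≈⟨ ⊕-congˡ {s ⊛ t ⊛ (t ⊛ t ↑ n ⊛ y₂)} (⊛-congˡ {s} (⊕-congˡ {k ⊛ (𝟙 ⊕ t ⊛ t) ⊛ t ↑ n ⊛ y₂} (⊛-congˡ {t ⊛ t ↑ n} (D-y (suc (suc n)))))) ⟩
    s ⊛ t ⊛ (t ⊛ t ↑ n ⊛ y₂) ⊕ s ⊛ (k ⊛ (𝟙 ⊕ t ⊛ t) ⊛ t ↑ n ⊛ y₂ ⊕ t ⊛ t ↑ n ⊛ ((𝟙 ⊕ k) ⊛ t ⊛ y₂ ⊕ (𝟙 ⊕ k) ⊛ (𝟙 ⊕ k) ⊛ y (suc n)))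
      ≈⟨ solve 6 (λ s t k u y₁ y₀ →
           let y₂ = (con 1 :+ k :+ k) :* t :* y₁ :+ k :* k :* y₀; k′ = con 1 :+ k in
           s :* t :* (t :* u :* y₂) :+ s :* (k :* (con 1 :+ t :* t) :* u :* y₂ :+ t :* u :* (k′ :* t :* y₂ :+ k′ :* k′ :* y₁)) :=
           (k′ :+ k′) :* (s :* (t :* (t :* u) :* y₂)) :+
             ((k′ :* k′ :+ k :* (con 1 :+ k :+ k)) :* (s :* (t :* u :* y₁)) :+ k :* k :* k :* (s :* (u :* y₀)))) (λ _ → refl) s t k (t ↑ n) (y (suc n)) (y n) ⟩
    (ν (suc (suc n)) ⊕ ν (suc (suc n))) ⊛ S (suc (suc n)) ⊕
      (((𝟙 ⊕ k) ⊛ (𝟙 ⊕ k) ⊕ k ⊛ (𝟙 ⊕ k ⊕ k)) ⊛ S (suc n) ⊕ k ⊛ k ⊛ k ⊛ S n) ∎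
    where
    open ≗-Reasoning
    k y₂ : Series
    k = ν (suc n)
    y₂ = y (suc (suc n))

open ≡-Reasoning

-- Determinants

sum-linear : ∀ {n} (f : Vector ℚ n) x (g : Vector ℚ n) → sum (λ j → f j + x * g j) ≡ sum f + x * sum g
sum-linear f x g = trans (∑-distrib-+ f (λ j → x * g j)) (cong (sum f +_) (sym (*-distribˡ-sum x g)))

sum-zero : ∀ {n} {f : Vector ℚ n} → (∀ k → f k ≡ 0ℚ) → sum f ≡ 0ℚ
sum-zero {zero}  f≗0 = refl
sum-zero {suc n} f≗0 = cong₂ _+_ (f≗0 zero) (sum-zero (f≗0 ∘ suc))

sgn : ∀ {n} → Fin n → ℚ
sgn j = (- 1ℚ) ^ toℕ j

-- D g stands for the minor on the columns selected by g.
laplace : ∀ {n} → Vector ℚ (suc n) → ((Fin n → Fin (suc n)) → ℚ) → ℚ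
laplace a D = sum λ j → sgn j * a j * D (punchIn j)

laplace-congˡ : ∀ {n} {a b : Vector ℚ (suc n)} D → a ≗ b → laplace a D ≡ laplace b D
laplace-congˡ D a≗b = sum-cong-≗ λ j → cong (λ u → sgn j * u * D (punchIn j)) (a≗b j)

laplace-congʳ : ∀ {n} (a : Vector ℚ (suc n)) D E → (∀ j → D (punchIn j) ≡ E (punchIn j)) →
                laplace a D ≡ laplace a E
laplace-congʳ a D E D≗E = sum-cong-≗ λ j → cong (sgn j * a j *_) (D≗E j)

laplace-linearˡ : ∀ {n} (a : Vector ℚ (suc n)) x b D →
                  laplace (λ j → a j + x * b j) D ≡ laplace a D + x * laplace b D
laplace-linearˡ a x b D = trans
  (sum-cong-≗ λ j → expand (sgn j) (a j) x (b j) (D (punchIn j)))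
  (sum-linear (λ j → sgn j * a j * D (punchIn j)) x (λ j → sgn j * b j * D (punchIn j)))
  where
  expand : ∀ s a x b d → s * (a + x * b) * d ≡ s * a * d + x * (s * b * d)
  expand = solve-∀ ℚ-ring

laplace-linearʳ : ∀ {n} (a : Vector ℚ (suc n)) D x E →
                  laplace a (λ g → D g + x * E g) ≡ laplace a D + x * laplace a E
laplace-linearʳ a D x E = trans
  (sum-cong-≗ λ j → expand (sgn j) (a j) (D (punchIn j)) x (E (punchIn j)))
  (sum-linear (λ j → sgn j * a j * D (punchIn j)) x (λ j → sgn j * a j * E (punchIn j)))
  where
  expand : ∀ s a d x e → s * a * (d + x * e) ≡ s * a * d + x * (s * a * e)
  expand = solve-∀ ℚ-ring

laplace-scaleˡ : ∀ {n} x (a : Vector ℚ (suc n)) D → laplace (λ j → x * a j) D ≡ x * laplace a D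
laplace-scaleˡ x a D = trans
  (sum-cong-≗ λ j → move (sgn j) x (a j) (D (punchIn j)))
  (sym (*-distribˡ-sum x λ j → sgn j * a j * D (punchIn j)))
  where
  move : ∀ s x a d → s * (x * a) * d ≡ x * (s * a * d)
  move = solve-∀ ℚ-ring

laplace-scaleʳ : ∀ {n} x (a : Vector ℚ (suc n)) D → laplace a (λ g → x * D g) ≡ x * laplace a D
laplace-scaleʳ x a D = trans
  (sum-cong-≗ λ j → move (sgn j) x (a j) (D (punchIn j)))
  (sym (*-distribˡ-sum x λ j → sgn j * a j * D (punchIn j)))
  where
  move : ∀ s x a d → s * a * (x * d) ≡ x * (s * a * d)
  move = solve-∀ ℚ-ring

-- Column selections compose, so expansions along successive rows nest. With the remaining minors
-- abstracted to a functional `D`, exchanging two rows becomes a statement about `a` and `b` alone,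
-- open to induction on the columns.
laplace₂ : ∀ {n} → Vector ℚ (suc (suc n)) → Vector ℚ (suc (suc n)) → ((Fin n → Fin (suc (suc n))) → ℚ) → ℚ
laplace₂ a b D = laplace a λ g → laplace (b ∘ g) λ h → D (g ∘ h)

lift : ∀ {m n} → (Fin m → Fin n) → Fin (suc m) → Fin (suc n)
lift g zero    = zero
lift g (suc i) = suc (g i)

-- Different composites of `punchIn` can select the same columns pointwise without being the same
-- function term.
Extensional : ∀ {m n} → ((Fin m → Fin n) → ℚ) → Set
Extensional D = ∀ g h → g ≗ h → D g ≡ D h

-- The part of laplace₂ a b D in which column zero is left over.
laplace₂⁺ : ∀ {n} → Vector ℚ (suc (suc n)) → Vector ℚ (suc (suc n)) → ((Fin n → Fin (suc (suc n))) → ℚ) → ℚ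
laplace₂⁺ {zero}  a b D = 0ℚ
laplace₂⁺ {suc n} a b D = laplace₂ (tail a) (tail b) (D ∘ lift)

-- Sorted by the fate of column zero: taken by `a`, taken by `b`, or left over. Dropping it lowers
-- positions by one; a single change of sign gives the minus of the second case, and two changes
-- cancel in the third.
laplace₂-split : ∀ {n} (a b : Vector ℚ (suc (suc n))) D → Extensional D →
  let D₀ = λ (g : Fin n → Fin (suc n)) → D (suc ∘ g) in
  laplace₂ a b D ≡ a zero * laplace (tail b) D₀ - b zero * laplace (tail a) D₀ + laplace₂⁺ a b D
laplace₂-split {n} a b D ext = begin
  1ℚ * a zero * W + sum (λ j → sgn (suc j) * a (suc j) * laplace (b ∘ punchIn (suc j)) (λ h → D (punchIn (suc j) ∘ h)))
    ≡⟨ cong₂ _+_ (cong (_* W) (*-identityˡ (a zero))) (sum-cong-≗ λ j → expand (sgn j) (a (suc j)) (b zero) (D₀ (punchIn j)) (inner b D j)) ⟩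
  a zero * W + sum (λ j → - b zero * (sgn j * a (suc j) * D₀ (punchIn j)) + - 1ℚ * (sgn j * a (suc j) * inner b D j))
    ≡⟨ cong (a zero * W +_) (sum-linear (λ j → - b zero * (sgn j * a (suc j) * D₀ (punchIn j))) (- 1ℚ) (λ j → sgn j * a (suc j) * inner b D j)) ⟩
  a zero * W + (sum (λ j → - b zero * (sgn j * a (suc j) * D₀ (punchIn j))) + - 1ℚ * sum (λ j → sgn j * a (suc j) * inner b D j))
    ≡⟨ cong₂ (λ u v → a zero * W + (u + v)) (sym (*-distribˡ-sum (- b zero) λ j → sgn j * a (suc j) * D₀ (punchIn j))) (inner-sum a b D ext) ⟩
  a zero * W + (- b zero * laplace (tail a) D₀ + laplace₂⁺ a b D)
    ≡⟨ regroup (a zero) W (b zero) (laplace (tail a) D₀) (laplace₂⁺ a b D) ⟩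
  a zero * W - b zero * laplace (tail a) D₀ + laplace₂⁺ a b D ∎
  where
  D₀ : (Fin n → Fin (suc n)) → ℚ
  D₀ g = D (suc ∘ g)
  W : ℚ
  W = laplace (tail b) D₀
  inner : ∀ {n} (b : Vector ℚ (suc (suc n))) (D : (Fin n → Fin (suc (suc n))) → ℚ) → Fin (suc n) → ℚ
  inner b D j = sum λ k → sgn (suc k) * b (suc (punchIn j k)) * D (punchIn (suc j) ∘ punchIn (suc k))
  expand : ∀ s a b d i → (- 1ℚ * s) * a * (1ℚ * b * d + i) ≡ - b * (s * a * d) + - 1ℚ * (s * a * i)
  expand = solve-∀ ℚ-ring
  regroup : ∀ a x b y r → a * x + (- b * y + r) ≡ a * x - b * y + r
  regroup = solve-∀ ℚ-ring
  inner-sum : ∀ {n} (a b : Vector ℚ (suc (suc n))) D → Extensional D →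
    - 1ℚ * sum (λ j → sgn j * a (suc j) * inner b D j) ≡ laplace₂⁺ a b D
  inner-sum {zero}  a b D ext = zeroOut (a (suc zero))
    where
    zeroOut : ∀ x → - 1ℚ * (1ℚ * x * 0ℚ + 0ℚ) ≡ 0ℚ
    zeroOut = solve-∀ ℚ-ring
  inner-sum {suc n} a b D ext = trans
    (*-distribˡ-sum (- 1ℚ) λ j → sgn j * a (suc j) * inner b D j)
    (sum-cong-≗ λ j → trans (move (sgn j) (a (suc j)) (inner b D j)) (cong (sgn j * a (suc j) *_) (trans
      (*-distribˡ-sum (- 1ℚ) λ k → sgn (suc k) * b (suc (punchIn j k)) * D (punchIn (suc j) ∘ punchIn (suc k)))
      (sum-cong-≗ λ k → trans (sign (sgn k) (b (suc (punchIn j k))) (D (punchIn (suc j) ∘ punchIn (suc k))))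
        (cong (sgn k * b (suc (punchIn j k)) *_) (ext _ (lift (punchIn j ∘ punchIn k)) λ { zero → refl ; (suc i) → refl }))))))
    where
    move : ∀ s a i → - 1ℚ * (s * a * i) ≡ s * a * (- 1ℚ * i)
    move = solve-∀ ℚ-ring
    sign : ∀ s b d → - 1ℚ * ((- 1ℚ * s) * b * d) ≡ s * b * d
    sign = solve-∀ ℚ-ring

-- Exchanging `a` and `b` swaps the first two terms of the split, which have opposite signs; the
-- third is the same statement with one column fewer.
laplace₂-antisym : ∀ {n} (a b : Vector ℚ (suc (suc n))) D → Extensional D → laplace₂ a b D ≡ - laplace₂ b a D
laplace₂-antisym {n} a b D ext = begin
  laplace₂ a b D                      ≡⟨ laplace₂-split a b D ext ⟩
  x - y + laplace₂⁺ a b D             ≡⟨ cong (x - y +_) (laplace₂⁺-antisym a b D ext) ⟩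
  x - y + - laplace₂⁺ b a D           ≡⟨ flip x y (laplace₂⁺ b a D) ⟩
  - (y - x + laplace₂⁺ b a D)         ≡⟨ cong -_ (laplace₂-split b a D ext) ⟨
  - laplace₂ b a D                    ∎
  where
  x y : ℚ
  x = a zero * laplace (tail b) (λ g → D (suc ∘ g))
  y = b zero * laplace (tail a) (λ g → D (suc ∘ g))
  flip : ∀ x y r → x - y + - r ≡ - (y - x + r)
  flip = solve-∀ ℚ-ring
  laplace₂⁺-antisym : ∀ {n} (a b : Vector ℚ (suc (suc n))) D → Extensional D → laplace₂⁺ a b D ≡ - laplace₂⁺ b a D
  laplace₂⁺-antisym {zero}  a b D ext = refl
  laplace₂⁺-antisym {suc n} a b D ext = laplace₂-antisym (tail a) (tail b) (D ∘ lift)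
    λ g h g≗h → ext (lift g) (lift h) λ { zero → refl ; (suc i) → cong suc (g≗h i) }

laplace₂-alternating : ∀ {n} (a : Vector ℚ (suc (suc n))) D → Extensional D → laplace₂ a a D ≡ 0ℚ
laplace₂-alternating a D ext = begin
  W             ≡⟨ halve W ⟩
  ½ * (W + W)   ≡⟨ cong (λ u → ½ * (W + u)) (laplace₂-antisym a a D ext) ⟩
  ½ * (W - W)   ≡⟨ cancel W ⟩
  0ℚ            ∎
  where
  W : ℚ
  W = laplace₂ a a D
  halve : ∀ x → x ≡ ½ * (x + x)
  halve = solve-∀ ℚ-ring
  cancel : ∀ x → ½ * (x - x) ≡ 0ℚ
  cancel = solve-∀ ℚ-ring

minor : ∀ {m n} → (Fin m → Vector ℚ n) → (Fin m → Fin n) → ℚ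
minor B g = det λ i → B i ∘ g

det-cong : ∀ {n} (A B : Matrix n) → (∀ i j → A i j ≡ B i j) → det A ≡ det B
det-cong {zero}  A B A≗B = refl
det-cong {suc n} A B A≗B = trans
  (laplace-congˡ (minor (tail A)) (A≗B zero))
  (laplace-congʳ (B zero) (minor (tail A)) (minor (tail B)) λ j →
    det-cong (λ i → A (suc i) ∘ punchIn j) (λ i → B (suc i) ∘ punchIn j) λ i k → A≗B (suc i) (punchIn j k))

minor-ext : ∀ {m n} (B : Fin m → Vector ℚ n) → Extensional (minor B)
minor-ext B g h g≗h = det-cong (λ i → B i ∘ g) (λ i → B i ∘ h) λ i j → cong (B i) (g≗h j)

-- Moving the second row to the front (which changes the sign) lets the
-- induction hypothesis act on the minors, whose first row is a again.
det-addFirstRow : ∀ {n} (a : Vector ℚ (suc n)) (B : Fin n → Vector ℚ (suc n)) (c : Vector ℚ n) →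
  det (a ∷ᶠ λ i j → B i j + c i * a j) ≡ det (a ∷ᶠ B)
det-addFirstRow {zero}  a B c = refl
det-addFirstRow {suc n} a B c = begin
  laplace₂ a (λ j → b j + c zero * a j) (minor B₊′)
    ≡⟨ laplace-congʳ a (λ g → laplace (λ j → b (g j) + c zero * a (g j)) (E g)) (λ g → laplace (b ∘ g) (E g) + c zero * laplace (a ∘ g) (E g))
         (λ j → laplace-linearˡ (b ∘ punchIn j) (c zero) (a ∘ punchIn j) (E (punchIn j))) ⟩
  laplace a (λ g → laplace (b ∘ g) (E g) + c zero * laplace (a ∘ g) (E g))
    ≡⟨ laplace-linearʳ a (λ g → laplace (b ∘ g) (E g)) (c zero) (λ g → laplace (a ∘ g) (E g)) ⟩
  laplace₂ a b (minor B₊′) + c zero * laplace₂ a a (minor B₊′)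
    ≡⟨ cong (λ u → laplace₂ a b (minor B₊′) + c zero * u) (laplace₂-alternating a (minor B₊′) (minor-ext B₊′)) ⟩
  laplace₂ a b (minor B₊′) + c zero * 0ℚ
    ≡⟨ dropZero (laplace₂ a b (minor B₊′)) (c zero) ⟩
  laplace₂ a b (minor B₊′)
    ≡⟨ laplace₂-antisym a b (minor B₊′) (minor-ext B₊′) ⟩
  - laplace₂ b a (minor B₊′)
    ≡⟨ cong -_ (laplace-congʳ b (λ g → laplace (a ∘ g) (E g)) (λ g → laplace (a ∘ g) (λ h → minor B₊ (g ∘ h)))
         (λ j → det-addFirstRow (a ∘ punchIn j) (λ i → B₊ i ∘ punchIn j) (tail c))) ⟩
  - laplace₂ b a (minor B₊)
    ≡⟨ laplace₂-antisym a b (minor B₊) (minor-ext B₊) ⟨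
  laplace₂ a b (minor B₊) ∎
  where
  b : Vector ℚ (suc (suc n))
  b = B zero
  B₊ B₊′ : Fin n → Vector ℚ (suc (suc n))
  B₊ = tail B
  B₊′ i j = B₊ i j + c (suc i) * a j
  E : (Fin (suc n) → Fin (suc (suc n))) → (Fin n → Fin (suc n)) → ℚ
  E g h = minor B₊′ (g ∘ h)
  dropZero : ∀ x c → x + c * 0ℚ ≡ x
  dropZero = solve-∀ ℚ-ring

∏ : ℕ → (ℕ → ℚ) → ℚ
∏ zero    f = 1ℚ
∏ (suc n) f = f 0 * ∏ n (f ∘ suc)

combineRows : ∀ {m n} → (ℕ → ℕ → ℚ) → (Fin m → Vector ℚ n) → Fin m → Vector ℚ n
combineRows L B i j = sum λ k → L (toℕ i) (toℕ k) * B k j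

-- The first row of the product is `L 0 0` times that of `B`. By `det-addFirstRow` the other rows
-- may drop their multiples of `B zero`, and the minors are then again products with a lower
-- triangular factor, namely `L₁`.
det-lowerTriangular-* : ∀ {n} (L : ℕ → ℕ → ℚ) (B : Matrix n) → (∀ {i k} → i ℕ.< k → L i k ≡ 0ℚ) →
  det (combineRows L B) ≡ ∏ n (λ i → L i i) * det B
det-lowerTriangular-* {zero}  L B lower = refl
det-lowerTriangular-* {suc n} L B lower = begin
  det (combineRows L B)
    ≡⟨ det-cong (combineRows L B) ((λ j → L 0 0 * B zero j) ∷ᶠ R) (λ
         { zero    j → trans (cong (L 0 0 * B zero j +_) (vanish j)) (+-identityʳ _)
         ; (suc i) j → +-comm (L (suc (toℕ i)) 0 * B zero j) _ }) ⟩
  laplace (λ j → L 0 0 * B zero j) (minor R)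
    ≡⟨ laplace-scaleˡ (L 0 0) (B zero) (minor R) ⟩
  L 0 0 * det (B zero ∷ᶠ R)
    ≡⟨ cong (L 0 0 *_) (det-addFirstRow (B zero) R₀ (λ i → L (suc (toℕ i)) 0)) ⟩
  L 0 0 * laplace (B zero) (minor R₀)
    ≡⟨ cong (L 0 0 *_) (laplace-congʳ (B zero) (minor R₀) (λ g → ∏L * minor (tail B) g)
         λ j → det-lowerTriangular-* L₁ (λ i → B (suc i) ∘ punchIn j) (lower ∘ s≤s)) ⟩
  L 0 0 * laplace (B zero) (λ g → ∏L * minor (tail B) g)
    ≡⟨ cong (L 0 0 *_) (laplace-scaleʳ ∏L (B zero) (minor (tail B))) ⟩
  L 0 0 * (∏L * det B)
    ≡⟨ *-assoc (L 0 0) ∏L (det B) ⟨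
  L 0 0 * ∏L * det B ∎
  where
  L₁ : ℕ → ℕ → ℚ
  L₁ i k = L (suc i) (suc k)
  ∏L : ℚ
  ∏L = ∏ n λ i → L₁ i i
  R₀ R : Fin n → Vector ℚ (suc n)
  R₀ = combineRows L₁ (tail B)
  R i j = R₀ i j + L (suc (toℕ i)) 0 * B zero j
  vanish : ∀ j → sum (λ k → L 0 (suc (toℕ k)) * B (suc k) j) ≡ 0ℚ
  vanish j = sum-zero λ k → trans (cong (_* B (suc k) j) (lower (s≤s z≤n))) (*-zeroˡ (B (suc k) j))

det-zeroColumn : ∀ {n} (A : Matrix (suc n)) → (∀ i → A i zero ≡ 0ℚ) → det A ≡ 0ℚ
det-zeroColumn A A≗0 = sum-zero {f = λ j → sgn j * A zero j * m j} λ
  { zero    → trans (cong (λ u → 1ℚ * u * m zero) (A≗0 zero)) (*-zeroˡ (m zero))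
  ; (suc j) → later A A≗0 j }
  where
  m : Fin _ → ℚ
  m j = minor (tail A) (punchIn j)
  later : ∀ {n} (A : Matrix (suc n)) → (∀ i → A i zero ≡ 0ℚ) → ∀ j → sgn (suc j) * A zero (suc j) * minor (tail A) (punchIn (suc j)) ≡ 0ℚ
  later {suc n} A A≗0 j = trans
    (cong (sgn (suc j) * A zero (suc j) *_) (det-zeroColumn (λ i → A (suc i) ∘ punchIn (suc j)) (A≗0 ∘ suc)))
    (*-zeroʳ (sgn (suc j) * A zero (suc j)))

-- Every minor but the first keeps column zero, which vanishes below the first row.
det-upperTriangular : ∀ {n} (f : ℕ → ℕ → ℚ) → (∀ {i j} → j ℕ.< i → f i j ≡ 0ℚ) →
  det {n} (λ i j → f (toℕ i) (toℕ j)) ≡ ∏ n (λ i → f i i)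
det-upperTriangular {zero}  f upper = refl
det-upperTriangular {suc n} f upper = trans
  (cong₂ _+_ (cong₂ _*_ (*-identityˡ (f 0 0)) (det-upperTriangular {n} (λ i j → f (suc i) (suc j)) (upper ∘ s≤s)))
    (sum-zero (later n f upper)))
  (+-identityʳ _)
  where
  later : ∀ n (f : ℕ → ℕ → ℚ) → (∀ {i j} → j ℕ.< i → f i j ≡ 0ℚ) → ∀ (j : Fin n) →
    sgn (suc j) * f 0 (suc (toℕ j)) * minor {n} (λ i j → f (suc (toℕ i)) (toℕ j)) (punchIn (suc j)) ≡ 0ℚ
  later (suc n) f upper j = trans
    (cong (sgn (suc j) * f 0 (suc (toℕ j)) *_) (det-zeroColumn (λ i k → f (suc (toℕ i)) (toℕ (punchIn (suc j) k))) (λ i → upper (s≤s z≤n))))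
    (*-zeroʳ (sgn (suc j) * f 0 (suc (toℕ j))))

∏-cong : ∀ n {f g : ℕ → ℚ} → (∀ i → f i ≡ g i) → ∏ n f ≡ ∏ n g
∏-cong zero    f≗g = refl
∏-cong (suc n) f≗g = cong₂ _*_ (f≗g 0) (∏-cong n (f≗g ∘ suc))

∏-snoc : ∀ n f → ∏ (suc n) f ≡ ∏ n f * f n
∏-snoc zero    f = *-comm (f 0) 1ℚ
∏-snoc (suc n) f = trans (cong (f 0 *_) (∏-snoc n (f ∘ suc))) (sym (*-assoc (f 0) (∏ n (f ∘ suc)) (f (suc n))))

-- Linear combinations with a leading term

δ : ℕ → ℕ → ℚ
δ zero    zero    = 1ℚ
δ zero    (suc k) = 0ℚ
δ (suc i) zero    = 0ℚ
δ (suc i) (suc k) = δ i k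

δ-diagonal : ∀ i → δ i i ≡ 1ℚ
δ-diagonal zero    = refl
δ-diagonal (suc i) = δ-diagonal i

δ-upper : ∀ {i k} → i ℕ.< k → δ i k ≡ 0ℚ
δ-upper {zero}  (s≤s i<k) = refl
δ-upper {suc i} (s≤s i<k) = δ-upper i<k

sum-δ : ∀ {i N} (h : ℕ → ℚ) → i ℕ.< N → sum {N} (λ k → δ i (toℕ k) * h (toℕ k)) ≡ h i
sum-δ {zero}  {suc N} h i<N = trans
  (cong₂ _+_ (*-identityˡ (h 0)) (sum-zero {N} λ k → *-zeroˡ (h (suc (toℕ k)))))
  (+-identityʳ (h 0))
sum-δ {suc i} {suc N} h (s≤s i<N) = trans
  (cong₂ _+_ (*-zeroˡ (h 0)) (sum-δ {i} {N} (h ∘ suc) i<N))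
  (+-identityˡ (h (suc i)))

-- Span B i f: the sequence f is a linear combination of B 0, …, B (i - 1).
data Span (B : ℕ → Series) : ℕ → Series → Set where
  none : ∀ {f} → (∀ j → f j ≡ 0ℚ) → Span B 0 f
  more : ∀ {i f g} e → Span B i g → (∀ j → f j ≡ e * B i j + g j) → Span B (suc i) f

-- One row of a triangular change of basis, with diagonal entry `e`. Determinants see only this
-- entry, so the remainder stays unspecified.
record Leads (B : ℕ → Series) (i : ℕ) (e : ℚ) (f : Series) : Set where
  constructor leads
  field
    {remainder} : Series
    lower       : Span B i remainder
    split       : ∀ j → f j ≡ e * B i j + remainder j

Leads⇒Span : ∀ {B i e f} → Leads B i e f → Span B (suc i) f
Leads⇒Span {e = e} (leads s f≗) = more e s f≗

Span-linear : ∀ {B i f g} a b → Span B i f → Span B i g → Span B i (λ j → a * f j + b * g j)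
Span-linear a b (none f≗0) (none g≗0) = none λ j →
  trans (cong₂ (λ u v → a * u + b * v) (f≗0 j) (g≗0 j)) (annihilate a b)
  where
  annihilate : ∀ a b → a * 0ℚ + b * 0ℚ ≡ 0ℚ
  annihilate = solve-∀ ℚ-ring
Span-linear {B} {suc i} a b (more {g = f′} e s f≗) (more {g = g′} e′ s′ g≗) = more (a * e + b * e′) (Span-linear a b s s′) λ j →
  trans (cong₂ (λ u v → a * u + b * v) (f≗ j) (g≗ j)) (collect a b e e′ (B i j) (f′ j) (g′ j))
  where
  collect : ∀ a b e e′ x u v → a * (e * x + u) + b * (e′ * x + v) ≡ (a * e + b * e′) * x + (a * u + b * v)
  collect = solve-∀ ℚ-ring

Span-resp-≗ : ∀ {B i f g} → f ≗ g → Span B i f → Span B i g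
Span-resp-≗ f≗g (none f≗0)     = none λ j → trans (sym (f≗g j)) (f≗0 j)
Span-resp-≗ f≗g (more e s f≗h) = more e s λ j → trans (sym (f≗g j)) (f≗h j)

Span-scale : ∀ {B i f} e → Span B i f → Span B i (λ j → e * f j)
Span-scale {f = f} e s = Span-resp-≗ (λ j → simplify e (f j)) (Span-linear e 0ℚ s s)
  where
  simplify : ∀ e x → e * x + 0ℚ * x ≡ e * x
  simplify = solve-∀ ℚ-ring

Span-+ : ∀ {B i f g} → Span B i f → Span B i g → Span B i (λ j → f j + g j)
Span-+ {f = f} {g} s s′ = Span-resp-≗ (λ j → simplify (f j) (g j)) (Span-linear 1ℚ 1ℚ s s′)
  where
  simplify : ∀ x y → 1ℚ * x + 1ℚ * y ≡ x + y
  simplify = solve-∀ ℚ-ring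

Span-weaken : ∀ {B i f} → Span B i f → Span B (suc i) f
Span-weaken {B} {i} {f} s = more 0ℚ s λ j → pad (B i j) (f j)
  where
  pad : ∀ x y → y ≡ 0ℚ * x + y
  pad = solve-∀ ℚ-ring

Span-zero : ∀ {B} i → Span B i (λ _ → 0ℚ)
Span-zero zero    = none λ _ → refl
Span-zero (suc i) = Span-weaken (Span-zero i)

Span-basis : ∀ {B} i → Span B (suc i) (B i)
Span-basis {B} i = more 1ℚ (Span-zero i) λ j → unit (B i j)
  where
  unit : ∀ x → x ≡ 1ℚ * x + 0ℚ
  unit = solve-∀ ℚ-ring

Leads-resp-≗ : ∀ {B i e f g} → f ≗ g → Leads B i e f → Leads B i e g
Leads-resp-≗ f≗g (leads s split) = leads s λ j → trans (sym (f≗g j)) (split j)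

Leads-+ : ∀ {B i e f g} → Leads B i e f → Span B i g → Leads B i e (λ j → f j + g j)
Leads-+ {B} {i} {e} {g = g} (leads {r} s split) s′ = leads (Span-+ s s′) λ j →
  trans (cong (_+ g j) (split j)) (+-assoc (e * B i j) (r j) (g j))

-- Read off the derivation of the span and not off `f`, since nothing makes the sequences of `B`
-- independent.
coefficient : ∀ {B i f} → Span B i f → ℕ → ℚ
coefficient (none _)         k = 0ℚ
coefficient (more {i} e s _) k = coefficient s k + e * δ i k

coefficient-beyond : ∀ {B i f} (s : Span B i f) {k} → i ℕ.≤ k → coefficient s k ≡ 0ℚ
coefficient-beyond (none _)     i≤k = refl
coefficient-beyond (more e s _) i<k = trans
  (cong₂ (λ u v → u + e * v) (coefficient-beyond s (ℕ.<⇒≤ i<k)) (δ-upper i<k))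
  (annihilate e)
  where
  annihilate : ∀ e → 0ℚ + e * 0ℚ ≡ 0ℚ
  annihilate = solve-∀ ℚ-ring

coefficient-leading : ∀ {B i e f} (l : Leads B i e f) → coefficient (Leads⇒Span l) i ≡ e
coefficient-leading {i = i} {e} (leads s f≗) = trans
  (cong₂ (λ u v → u + e * v) (coefficient-beyond s ℕ.≤-refl) (δ-diagonal i))
  (unit e)
  where
  unit : ∀ e → 0ℚ + e * 1ℚ ≡ e
  unit = solve-∀ ℚ-ring

expansion : ∀ {B i f N} (s : Span B i f) → i ℕ.≤ N → ∀ j →
  f j ≡ sum {N} λ k → coefficient s (toℕ k) * B (toℕ k) j
expansion {B} {N = N} (none f≗0) i≤N j = trans (f≗0 j) (sym (sum-zero {N} λ k → *-zeroˡ (B (toℕ k) j)))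
expansion {B} {f = f} {N} (more {i} {g = g} e s f≗) i<N j = begin
  f j
    ≡⟨ f≗ j ⟩
  e * B i j + g j
    ≡⟨ +-comm (e * B i j) (g j) ⟩
  g j + e * B i j
    ≡⟨ cong₂ (λ u v → u + e * v) (expansion s (ℕ.<⇒≤ i<N) j) (sym (sum-δ (λ k → B k j) i<N)) ⟩
  sum {N} (λ k → coefficient s (toℕ k) * B (toℕ k) j) + e * sum {N} (λ k → δ i (toℕ k) * B (toℕ k) j)
    ≡⟨ sum-linear {N} (λ k → coefficient s (toℕ k) * B (toℕ k) j) e (λ k → δ i (toℕ k) * B (toℕ k) j) ⟨
  sum {N} (λ k → coefficient s (toℕ k) * B (toℕ k) j + e * (δ i (toℕ k) * B (toℕ k) j))
    ≡⟨ sum-cong-≗ {N} (λ k → factor (coefficient s (toℕ k)) e (δ i (toℕ k)) (B (toℕ k) j)) ⟩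
  sum {N} (λ k → (coefficient s (toℕ k) + e * δ i (toℕ k)) * B (toℕ k) j) ∎
  where
  factor : ∀ c e d x → c * x + e * (d * x) ≡ (c + e * d) * x
  factor = solve-∀ ℚ-ring

det-leads : ∀ {N} (f B : ℕ → Series) (e : ℕ → ℚ) → (∀ i → Leads B i (e i) (f i)) →
  det {N} (λ i j → f (toℕ i) (toℕ j)) ≡ ∏ N e * det {N} (λ i j → B (toℕ i) (toℕ j))
det-leads {N} f B e l = begin
  det {N} (λ i j → f (toℕ i) (toℕ j))
    ≡⟨ det-cong {N} (λ i j → f (toℕ i) (toℕ j)) (combineRows L B′) (λ i j → expansion (Leads⇒Span (l (toℕ i))) (toℕ<n i) (toℕ j)) ⟩
  det (combineRows L B′)
    ≡⟨ det-lowerTriangular-* L B′ (λ {i} → coefficient-beyond (Leads⇒Span (l i))) ⟩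
  ∏ N (λ i → L i i) * det B′
    ≡⟨ cong (_* det B′) (∏-cong N (λ i → coefficient-leading (l i))) ⟩
  ∏ N e * det B′ ∎
  where
  L : ℕ → ℕ → ℚ
  L i = coefficient (Leads⇒Span (l i))
  B′ : Matrix N
  B′ i j = B (toℕ i) (toℕ j)

shift₂ : Series → Series
shift₂ f j = f (suc (suc j))

module _ {B : ℕ → Series} {p : ℕ → ℚ} (step : ∀ k → Leads B (suc k) (p k) (shift₂ (B k))) where

  Span-shift₂ : ∀ {i f} → Span B i f → Span B (suc i) (shift₂ f)
  Span-shift₂ (none f≗0) = Span-weaken (none (λ j → f≗0 (suc (suc j))))
  Span-shift₂ (more {i} e s f≗) = Span-resp-≗ (λ j → sym (f≗ (suc (suc j))))
    (Span-+ (Span-scale e (Leads⇒Span (step i))) (Span-weaken (Span-shift₂ s)))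

  -- The rows f i are polynomials of degree i in the double shift, applied to B 0.
  shift₂-orbit : ∀ α β (f : ℕ → Series) → (∀ j → f 0 j ≡ B 0 j) →
    (∀ i j → f (suc i) j ≡ α * f i j + β * f i (suc (suc j))) →
    ∀ i → Leads B i (∏ i (λ k → β * p k)) (f i)
  shift₂-orbit α β f f₀ f₊ zero = leads (Span-zero 0) λ j → trans (f₀ j) (unit (B 0 j))
    where
    unit : ∀ x → x ≡ 1ℚ * x + 0ℚ
    unit = solve-∀ ℚ-ring
  shift₂-orbit α β f f₀ f₊ (suc i) with shift₂-orbit α β f f₀ f₊ i | step i
  ... | leads {g} s f≗ | leads {h} s′ B≗ =
    -- The new remainder has three parts: the multiple of `f i`, the double shift of the old
    -- remainder `g`, and the remainder `h` left by the double shift of `B i`.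
    leads (Span-+ (Span-linear α β (Leads⇒Span (leads {e = π} s f≗)) (Span-shift₂ s)) (Span-scale (β * π) s′)) λ j → begin
      f (suc i) j
        ≡⟨ f₊ i j ⟩
      α * f i j + β * f i (suc (suc j))
        ≡⟨ cong (λ u → α * f i j + β * u) (trans (f≗ (suc (suc j))) (cong (λ u → π * u + g (suc (suc j))) (B≗ j))) ⟩
      α * f i j + β * (π * (p i * B (suc i) j + h j) + g (suc (suc j)))
        ≡⟨ collect α β (f i j) π (p i) (B (suc i) j) (h j) (g (suc (suc j))) ⟩
      π * (β * p i) * B (suc i) j + (α * f i j + β * g (suc (suc j)) + β * π * h j)
        ≡⟨ cong (λ u → u * B (suc i) j + (α * f i j + β * g (suc (suc j)) + β * π * h j)) (∏-snoc i (λ k → β * p k)) ⟨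
      ∏ (suc i) (λ k → β * p k) * B (suc i) j + (α * f i j + β * g (suc (suc j)) + β * π * h j) ∎
    where
    π : ℚ
    π = ∏ i (λ k → β * p k)
    collect : ∀ α β f π p b h g → α * f + β * (π * (p * b + h) + g) ≡ π * (β * p) * b + (α * f + β * g + β * π * h)
    collect = solve-∀ ℚ-ring

-- The dilated Hankel determinant

module LegendreRows (s t l : Series) (Ds : D s ≗ s ⊛ t) (Dt : D t ≗ 𝟙 ⊕ t ⊛ t) (Dl : D l ≗ 𝟙) where

  open LegendreTower s t l Ds Dt Dl

  pivot : ℕ → ℚ
  pivot k = ν (suc k) 0 + ν (suc k) 0

  leads-D-Z : ∀ n → Leads S (suc n) (pivot n) (D (Z n))
  leads-D-Z zero    = leads (Span-basis 0) λ j → trans (D-Z₀ j)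
    (cong (_+ S 0 j) (constant-⊛ (ν 1 ⊕ ν 1) (D-⊕ (ν 1) (ν 1) (Dν 1) (Dν 1)) (S 1) j))
  leads-D-Z (suc n) = leads (Span-linear (a 0) (b 0) (Span-basis (suc n)) (Span-weaken (Span-basis n))) λ j → trans (D-Z₊ n j)
    (cong₂ _+_ (constant-⊛ (k′ ⊕ k′) (D-⊕ k′ k′ Dk′ Dk′) (S (suc (suc n))) j)
      (cong₂ _+_ (constant-⊛ a (D-⊕ (k′ ⊛ k′) (k ⊛ (k′ ⊕ k)) (D-⊛ k′ k′ Dk′ Dk′) (D-⊛ k (k′ ⊕ k) Dk (D-⊕ k′ k Dk′ Dk))) (S (suc n)) j)
                 (constant-⊛ b (D-⊛ (k ⊛ k) k (D-⊛ k k Dk Dk) Dk) (S n) j)))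
    where
    k k′ a b : Series
    k = ν (suc n)
    k′ = ν (suc (suc n))
    a = (𝟙 ⊕ k) ⊛ (𝟙 ⊕ k) ⊕ k ⊛ (𝟙 ⊕ k ⊕ k)
    b = k ⊛ k ⊛ k
    Dk  = Dν (suc n)
    Dk′ = Dν (suc (suc n))

  -- Of the two terms D (Z (n+1)) and (n+1) D (Z n), only the first reaches S (n+2).
  leads-shift₂-S : ∀ k → Leads S (suc k) (pivot k) (shift₂ (S k))
  leads-shift₂-S zero    = Leads-resp-≗ (≗-sym (D-cong D-S₀)) (leads-D-Z 0)
  leads-shift₂-S (suc n) = Leads-resp-≗
    (≗-sym (≗-trans (D-cong (D-S₊ n)) (⊕-congˡ {D (Z (suc n))} (λ j → ν-⊛ (suc n) (Z n) (suc j)))))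
    (Leads-+ (leads-D-Z (suc n)) (Span-scale (ν (suc n) 0) (Leads⇒Span (leads-D-Z n))))

  module _ (t₀ : t 0 ≡ 0ℚ) where

    -- Each derivative strips one factor t. At t = 0 the cofactor is (n+1) f, whence the factorial
    -- in `↑⊛-at`.
    D-↑⊛ : ∀ n f → D (t ↑ suc n ⊛ f) ≗ t ↑ n ⊛ (ν (suc n) ⊛ (𝟙 ⊕ t ⊛ t) ⊛ f ⊕ t ⊛ D f)
    D-↑⊛ n f = ≗-trans (⊕-congʳ {t ↑ suc n ⊛ D f} (⊛-congʳ {f} (D-↑ n)))
      (solve 5 (λ k t u f f′ → k :* (con 1 :+ t :* t) :* u :* f :+ t :* u :* f′ := u :* (k :* (con 1 :+ t :* t) :* f :+ t :* f′))
        (λ _ → refl) (ν (suc n)) t (t ↑ n) f (D f))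

    ↑⊛-below : ∀ n f {j} → j ℕ.< n → (t ↑ n ⊛ f) j ≡ 0ℚ
    ↑⊛-below (suc n) f {zero}  _         = trans (cong (λ u → u * (t ↑ n) 0 * f 0) t₀) (annihilate ((t ↑ n) 0) (f 0))
      where
      annihilate : ∀ u f → 0ℚ * u * f ≡ 0ℚ
      annihilate = solve-∀ ℚ-ring
    ↑⊛-below (suc n) f {suc j} (s≤s j<n) = trans (D-↑⊛ n f j) (↑⊛-below n _ j<n)

    ↑⊛-at : ∀ n f → (t ↑ n ⊛ f) n ≡ ∏ n (λ k → ν (suc k) 0) * f 0
    ↑⊛-at zero    f = refl
    ↑⊛-at (suc n) f = begin
      D (t ↑ suc n ⊛ f) n
        ≡⟨ D-↑⊛ n f n ⟩
      (t ↑ n ⊛ (ν (suc n) ⊛ (𝟙 ⊕ t ⊛ t) ⊛ f ⊕ t ⊛ D f)) n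
        ≡⟨ ↑⊛-at n _ ⟩
      ∏ n (λ k → ν (suc k) 0) * (ν (suc n) 0 * (1ℚ + t 0 * t 0) * f 0 + t 0 * f 1)
        ≡⟨ cong (λ u → ∏ n (λ k → ν (suc k) 0) * (ν (suc n) 0 * (1ℚ + u * u) * f 0 + u * f 1)) t₀ ⟩
      ∏ n (λ k → ν (suc k) 0) * (ν (suc n) 0 * (1ℚ + 0ℚ * 0ℚ) * f 0 + 0ℚ * f 1)
        ≡⟨ simplify (∏ n (λ k → ν (suc k) 0)) (ν (suc n) 0) (f 0) (f 1) ⟩
      ∏ n (λ k → ν (suc k) 0) * ν (suc n) 0 * f 0
        ≡⟨ cong (_* f 0) (∏-snoc n (λ k → ν (suc k) 0)) ⟨
      ∏ (suc n) (λ k → ν (suc k) 0) * f 0 ∎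
      where
      simplify : ∀ π k f f′ → π * (k * (1ℚ + 0ℚ * 0ℚ) * f + 0ℚ * f′) ≡ π * k * f
      simplify = solve-∀ ℚ-ring

    S-swap : ∀ n → S n ≗ t ↑ n ⊛ (s ⊛ y n)
    S-swap n = solve 3 (λ s u y → s :* (u :* y) := u :* (s :* y)) (λ _ → refl) s (t ↑ n) (y n)

    S-below : ∀ {n j} → j ℕ.< n → S n j ≡ 0ℚ
    S-below {n} {j} j<n = trans (S-swap n j) (↑⊛-below n (s ⊛ y n) j<n)

    S-diagonal : ∀ n → S n n ≡ ∏ n (λ k → ν (suc k) 0) * (s 0 * y n 0)
    S-diagonal n = trans (S-swap n n) (↑⊛-at n (s ⊛ y n))

open LegendreTower secᴴ tanᴴ 1+x D-secᴴ D-tanᴴ D-1+x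
open LegendreRows secᴴ tanᴴ 1+x D-secᴴ D-tanᴴ D-1+x

F≗S₀ : F ≗ S 0
F≗S₀ = ≗-trans (divide-cosᴴ cosᴴ⊛F) (⊛-congˡ {secᴴ} (≗-sym (⊛-identityˡ 1+x)))

2*suc+ : ∀ i j → 2 ℕ.* suc i ℕ.+ j ≡ suc (suc (2 ℕ.* i ℕ.+ j))
2*suc+ = ℕ-solve-∀

2*+suc² : ∀ i j → 2 ℕ.* i ℕ.+ suc (suc j) ≡ suc (suc (2 ℕ.* i ℕ.+ j))
2*+suc² = ℕ-solve-∀

hankelEntry : ℕ → Series
hankelEntry i j = F (2 ℕ.* i ℕ.+ j)

det-hankel : ∀ N → dilatedHankel N (1+x ÷ˢ cos) ≡
  ∏ N (λ i → ∏ i (λ k → 1ℚ * pivot k)) * ∏ N (λ i → ∏ i (λ k → ν (suc k) 0) * (secᴴ 0 * y i 0))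
det-hankel N = begin
  det {N} (λ i j → hankelEntry (toℕ i) (toℕ j))
    ≡⟨ det-leads {N} hankelEntry S _ (shift₂-orbit {S} {pivot} leads-shift₂-S 0ℚ 1ℚ hankelEntry F≗S₀ next) ⟩
  ∏ N (λ i → ∏ i (λ k → 1ℚ * pivot k)) * det {N} (λ i j → S (toℕ i) (toℕ j))
    -- Both `refl` prove tan 0 = 0 by computation.
    ≡⟨ cong (∏ N (λ i → ∏ i (λ k → 1ℚ * pivot k)) *_) (trans (det-upperTriangular {N} S (S-below refl)) (∏-cong N (S-diagonal refl))) ⟩
  ∏ N (λ i → ∏ i (λ k → 1ℚ * pivot k)) * ∏ N (λ i → ∏ i (λ k → ν (suc k) 0) * (secᴴ 0 * y i 0)) ∎
  where
  next : ∀ i j → hankelEntry (suc i) j ≡ 0ℚ * hankelEntry i j + 1ℚ * hankelEntry i (suc (suc j))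
  next i j = trans (cong F (trans (2*suc+ i j) (sym (2*+suc² i j)))) (simplify (hankelEntry i j) (hankelEntry i (suc (suc j))))
    where
    simplify : ∀ x y → y ≡ 0ℚ * x + 1ℚ * y
    simplify = solve-∀ ℚ-ring

-- The evaluation of palindromic polynomials, on coefficient sequences

partialSum : Series → Series
partialSum c zero    = c 0
partialSum c (suc k) = partialSum c k + c (suc k)

partialSum-cong : ∀ {f g} → f ≗ g → partialSum f ≗ partialSum g
partialSum-cong f≗g zero    = f≗g 0
partialSum-cong f≗g (suc k) = cong₂ _+_ (partialSum-cong f≗g k) (f≗g (suc k))

combine : ∀ a b x y u v → a * x + b * y + (a * u + b * v) ≡ a * (x + u) + b * (y + v)
combine = solve-∀ ℚ-ring

partialSum-linear : ∀ a b f g k → partialSum (λ k → a * f k + b * g k) k ≡ a * partialSum f k + b * partialSum g k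
partialSum-linear a b f g zero    = refl
partialSum-linear a b f g (suc k) = trans
  (cong (_+ (a * f (suc k) + b * g (suc k))) (partialSum-linear a b f g k))
  (combine a b (partialSum f k) (partialSum g k) (f (suc k)) (g (suc k)))

mulX mul[1+X] mul[1-X] : Series → Series
mulX c zero    = 0ℚ
mulX c (suc k) = c k
mul[1+X] c k = c k + mulX c k
mul[1-X] c k = c k - mulX c k

mulX-cong : ∀ {f g} → f ≗ g → mulX f ≗ mulX g
mulX-cong f≗g zero    = refl
mulX-cong f≗g (suc k) = f≗g k

mul[1+X]-cong : ∀ {f g} → f ≗ g → mul[1+X] f ≗ mul[1+X] g
mul[1+X]-cong f≗g k = cong₂ _+_ (f≗g k) (mulX-cong f≗g k)

mul[1-X]-cong : ∀ {f g} → f ≗ g → mul[1-X] f ≗ mul[1-X] g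
mul[1-X]-cong f≗g k = cong₂ _-_ (f≗g k) (mulX-cong f≗g k)

mulX-linear : ∀ a b f g k → mulX (λ k → a * f k + b * g k) k ≡ a * mulX f k + b * mulX g k
mulX-linear a b f g zero    = annihilate a b
  where
  annihilate : ∀ a b → 0ℚ ≡ a * 0ℚ + b * 0ℚ
  annihilate = solve-∀ ℚ-ring
mulX-linear a b f g (suc k) = refl

mul[1-X]-linear : ∀ a b f g k → mul[1-X] (λ k → a * f k + b * g k) k ≡ a * mul[1-X] f k + b * mul[1-X] g k
mul[1-X]-linear a b f g k = trans (cong (λ u → a * f k + b * g k - u) (mulX-linear a b f g k))
  (regroup a b (f k) (g k) (mulX f k) (mulX g k))
  where
  regroup : ∀ a b x y u v → a * x + b * y - (a * u + b * v) ≡ a * (x - u) + b * (y - v)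
  regroup = solve-∀ ℚ-ring

mul[1-X]-mulX : ∀ c → mul[1-X] (mulX c) ≗ mulX (mul[1-X] c)
mul[1-X]-mulX c zero    = refl
mul[1-X]-mulX c (suc k) = refl

mul[1-X]-mul[1+X] : ∀ c → mul[1-X] (mul[1+X] c) ≗ mul[1+X] (mul[1-X] c)
mul[1-X]-mul[1+X] c zero    = solution (c 0)
  where
  solution : ∀ x → x + 0ℚ - 0ℚ ≡ x - 0ℚ + 0ℚ
  solution = solve-∀ ℚ-ring
mul[1-X]-mul[1+X] c (suc k) = solution (c (suc k)) (c k) (mulX c k)
  where
  solution : ∀ x y z → x + y - (y + z) ≡ x - y + (y - z)
  solution = solve-∀ ℚ-ring

partialSum-mul[1-X] : ∀ c → partialSum (mul[1-X] c) ≗ c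
partialSum-mul[1-X] c zero    = +-identityʳ (c 0)
partialSum-mul[1-X] c (suc k) = trans (cong (_+ (c (suc k) - c k)) (partialSum-mul[1-X] c k)) (telescope (c k) (c (suc k)))
  where
  telescope : ∀ x y → x + (y - x) ≡ y
  telescope = solve-∀ ℚ-ring

Supported : ℕ → Series → Set
Supported d c = ∀ {k} → d ℕ.< k → c k ≡ 0ℚ

mulX-supported : ∀ {d c} → Supported d c → Supported (suc d) (mulX c)
mulX-supported supp (s≤s d<k) = supp d<k

mul[1-X]-supported : ∀ {d c} → Supported d c → Supported (suc d) (mul[1-X] c)
mul[1-X]-supported {d} {c} supp d<k = cong₂ _-_ (supp (ℕ.<-trans (ℕ.n<1+n d) d<k)) (mulX-supported {d} {c} supp d<k)

mul[1+X]-supported : ∀ {d c} → Supported d c → Supported (suc d) (mul[1+X] c)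
mul[1+X]-supported {d} {c} supp d<k = cong₂ _+_ (supp (ℕ.<-trans (ℕ.n<1+n d) d<k)) (mulX-supported {d} {c} supp d<k)

δ-sym : ∀ i k → δ i k ≡ δ k i
δ-sym zero    zero    = refl
δ-sym zero    (suc k) = refl
δ-sym (suc i) zero    = refl
δ-sym (suc i) (suc k) = δ-sym i k

partialSum-δ₀ : ∀ k → partialSum (δ 0) k ≡ 1ℚ
partialSum-δ₀ zero    = refl
partialSum-δ₀ (suc k) = trans (+-identityʳ _) (partialSum-δ₀ k)

mulX-δ : ∀ d → mulX (δ d) ≗ δ (suc d)
mulX-δ d zero    = refl
mulX-δ d (suc k) = refl

partialSum-mulX : ∀ c k → partialSum (mulX c) (suc k) ≡ partialSum c k
partialSum-mulX c zero    = +-identityˡ (c 0)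
partialSum-mulX c (suc k) = cong (_+ c (suc k)) (partialSum-mulX c k)

partialSum-δ : ∀ d → partialSum (δ d) d ≡ 1ℚ
partialSum-δ zero    = refl
partialSum-δ (suc d) = trans (partialSum-cong (≗-sym (mulX-δ d)) (suc d)) (trans (partialSum-mulX (δ d) d) (partialSum-δ d))

-- The coefficients of (x^d + 1) P(1) - 2 P(x) for P of degree at most d, and
-- of its quotient by (1 - x)²: dividing a power series by 1 - x amounts to
-- taking partial sums.
numerator reduce : ℕ → Series → Series
numerator d c k = partialSum c d * (δ d k + δ 0 k) + - 1ℚ * (fromℕ 2 * c k)
reduce d c = partialSum (partialSum (numerator d c))

numerator-linear : ∀ d a b f g k → numerator d (λ k → a * f k + b * g k) k ≡ a * numerator d f k + b * numerator d g k
numerator-linear d a b f g k = trans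
  (cong (λ u → u * (δ d k + δ 0 k) + - 1ℚ * (fromℕ 2 * (a * f k + b * g k))) (partialSum-linear a b f g d))
  (regroup a b (partialSum f d) (partialSum g d) (δ d k + δ 0 k) (f k) (g k))
  where
  regroup : ∀ a b F G e x y → (a * F + b * G) * e + - 1ℚ * (fromℕ 2 * (a * x + b * y)) ≡
    a * (F * e + - 1ℚ * (fromℕ 2 * x)) + b * (G * e + - 1ℚ * (fromℕ 2 * y))
  regroup = solve-∀ ℚ-ring

reduce-linear : ∀ d a b f g → reduce d (λ k → a * f k + b * g k) ≗ λ k → a * reduce d f k + b * reduce d g k
reduce-linear d a b f g k = trans
  (partialSum-cong (λ i → trans (partialSum-cong (numerator-linear d a b f g) i)
    (partialSum-linear a b (numerator d f) (numerator d g) i)) k)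
  (partialSum-linear a b (partialSum (numerator d f)) (partialSum (numerator d g)) k)

numerator-cong : ∀ d {f g} → f ≗ g → numerator d f ≗ numerator d g
numerator-cong d f≗g k = cong₂ (λ u v → u * (δ d k + δ 0 k) + - 1ℚ * (fromℕ 2 * v)) (partialSum-cong f≗g d) (f≗g k)

reduce-cong : ∀ d {f g} → f ≗ g → reduce d f ≗ reduce d g
reduce-cong d f≗g = partialSum-cong (partialSum-cong (numerator-cong d f≗g))

-- ρ for palindromic polynomials of index d, which is passed on explicitly
-- instead of being recomputed at each step.
R : ℕ → Series → ℚ
R zero          c = c 0
R (suc zero)    c = c 0
R (suc (suc d)) c = R d (reduce (suc (suc d)) c)

R-cong : ∀ d {f g} → f ≗ g → R d f ≡ R d g
R-cong zero          f≗g = f≗g 0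
R-cong (suc zero)    f≗g = f≗g 0
R-cong (suc (suc d)) f≗g = R-cong d (reduce-cong (suc (suc d)) f≗g)

R-linear : ∀ d a b f g → R d (λ k → a * f k + b * g k) ≡ a * R d f + b * R d g
R-linear zero          a b f g = refl
R-linear (suc zero)    a b f g = refl
R-linear (suc (suc d)) a b f g = trans (R-cong d (reduce-linear (suc (suc d)) a b f g))
  (R-linear d a b (reduce (suc (suc d)) f) (reduce (suc (suc d)) g))

R-scale : ∀ d a f → R d (λ k → a * f k) ≡ a * R d f
R-scale d a f = trans (R-cong d λ k → pad a (f k)) (trans (R-linear d a 0ℚ f f) (sym (pad a (R d f))))
  where
  pad : ∀ a x → a * x ≡ a * x + 0ℚ * x
  pad = solve-∀ ℚ-ring

R-zero : ∀ d {f} → (∀ k → f k ≡ 0ℚ) → R d f ≡ 0ℚ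
R-zero d {f} f≗0 = trans (R-cong d λ k → trans (f≗0 k) (sym (*-zeroˡ (f k)))) (trans (R-scale d 0ℚ f) (*-zeroˡ (R d f)))

-- A multiple of (1 - x)² vanishes at 1, so only - 2 P is left of the numerator, and the two
-- divisions undo the two multiplications.
R-mul[1-X]² : ∀ d c → Supported d c → R (suc (suc d)) (mul[1-X] (mul[1-X] c)) ≡ - fromℕ 2 * R d c
R-mul[1-X]² d c supp = trans (R-cong d reduce≗) (R-scale d (- fromℕ 2) c)
  where
  total : partialSum (mul[1-X] (mul[1-X] c)) (suc (suc d)) ≡ 0ℚ
  -- The sum telescopes to the coefficient of (1 - x) c in degree d + 2, beyond its degree d + 1.
  total = trans (partialSum-mul[1-X] (mul[1-X] c) (suc (suc d))) (cong₂ _-_ (supp (ℕ.m≤n⇒m≤1+n ℕ.≤-refl)) (supp ℕ.≤-refl))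
  numerator≗ : ∀ k → numerator (suc (suc d)) (mul[1-X] (mul[1-X] c)) k ≡
    - fromℕ 2 * mul[1-X] (mul[1-X] c) k + 0ℚ * mul[1-X] (mul[1-X] c) k
  numerator≗ k = trans (cong (λ u → u * (δ (suc (suc d)) k + δ 0 k) + - 1ℚ * (fromℕ 2 * mul[1-X] (mul[1-X] c) k)) total)
    (regroup (δ (suc (suc d)) k + δ 0 k) (mul[1-X] (mul[1-X] c) k))
    where
    regroup : ∀ e x → 0ℚ * e + - 1ℚ * (fromℕ 2 * x) ≡ - fromℕ 2 * x + 0ℚ * x
    regroup = solve-∀ ℚ-ring
  drop : ∀ a x → a * x + 0ℚ * x ≡ a * x
  drop = solve-∀ ℚ-ring
  reduce≗ : ∀ k → reduce (suc (suc d)) (mul[1-X] (mul[1-X] c)) k ≡ - fromℕ 2 * c k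
  reduce≗ k = trans (partialSum-cong (λ i → trans (partialSum-cong numerator≗ i) (trans
      (partialSum-linear (- fromℕ 2) 0ℚ (mul[1-X] (mul[1-X] c)) (mul[1-X] (mul[1-X] c)) i)
      (cong (λ u → - fromℕ 2 * u + 0ℚ * u) (partialSum-mul[1-X] (mul[1-X] c) i)))) k)
    (trans (partialSum-linear (- fromℕ 2) 0ℚ (mul[1-X] c) (mul[1-X] c) k)
      (trans (cong (λ u → - fromℕ 2 * u + 0ℚ * u) (partialSum-mul[1-X] c k)) (drop (- fromℕ 2) (c k))))

-- Here P(1) = 2, so the numerator is 0 before any division. Below index 2 the evaluation makes no
-- step, hence the form `suc (suc d)`.
R-1+x^d : ∀ d → R (suc (suc d)) (λ k → δ 0 k + δ (suc (suc d)) k) ≡ 0ℚ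
R-1+x^d d = R-zero d λ k → partialSum-zero (λ i → partialSum-zero numerator≗0 i) k
  where
  e : ℕ
  e = suc (suc d)
  partialSum-zero : ∀ {f} → (∀ k → f k ≡ 0ℚ) → ∀ k → partialSum f k ≡ 0ℚ
  partialSum-zero f≗0 zero    = f≗0 0
  partialSum-zero f≗0 (suc k) = cong₂ _+_ (partialSum-zero f≗0 k) (f≗0 (suc k))
  total : partialSum (λ k → δ 0 k + δ e k) e ≡ fromℕ 2
  total = trans (partialSum-cong (λ k → cong₂ _+_ (sym (*-identityˡ (δ 0 k))) (sym (*-identityˡ (δ e k)))) e)
    (trans (partialSum-linear 1ℚ 1ℚ (δ 0) (δ e) e) (cong₂ (λ u v → 1ℚ * u + 1ℚ * v) (partialSum-δ₀ e) (partialSum-δ e)))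
  numerator≗0 : ∀ k → numerator e (λ k → δ 0 k + δ e k) k ≡ 0ℚ
  numerator≗0 k = trans (cong (λ u → u * (δ e k + δ 0 k) + - 1ℚ * (fromℕ 2 * (δ 0 k + δ e k))) total) (cancel (δ 0 k) (δ e k))
    where
    cancel : ∀ x y → fromℕ 2 * (y + x) + - 1ℚ * (fromℕ 2 * (x + y)) ≡ 0ℚ
    cancel = solve-∀ ℚ-ring

-- The first row of the matrix

[1+X]^_ : ℕ → Series
[1+X]^ zero    = δ 0
[1+X]^ (suc p) = mul[1+X] ([1+X]^ p)

[1+X]^-supported : ∀ p → Supported p ([1+X]^ p)
[1+X]^-supported zero    = δ-upper
[1+X]^-supported (suc p) = mul[1+X]-supported {p} {[1+X]^ p} ([1+X]^-supported p)

-- (1 + x)^p (1 - x)^q, the same with x - 1 for 1 - x, and their average,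
-- which vanishes for odd q.
T₊ T₋ T : ℕ → ℕ → Series
T₊ p zero            = [1+X]^ p
T₊ p (suc q)         = mul[1-X] (T₊ p q)
T₋ p zero            = [1+X]^ p
T₋ p (suc q) k       = - mul[1-X] (T₋ p q) k
T p zero             = [1+X]^ p
T p (suc zero) k     = 0ℚ
T p (suc (suc q))    = mul[1-X] (mul[1-X] (T p q))

mul[1-X]-neg : ∀ c → mul[1-X] (λ k → - c k) ≗ λ k → - mul[1-X] c k
mul[1-X]-neg c zero    = solution (c 0)
  where
  solution : ∀ x → - x - 0ℚ ≡ - (x - 0ℚ)
  solution = solve-∀ ℚ-ring
mul[1-X]-neg c (suc k) = solution (c (suc k)) (c k)
  where
  solution : ∀ x y → - x - (- y) ≡ - (x - y)
  solution = solve-∀ ℚ-ring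

T₊-suc : ∀ p q → T₊ (suc p) q ≗ mul[1+X] (T₊ p q)
T₊-suc p zero    k = refl
T₊-suc p (suc q) k = trans (mul[1-X]-cong (T₊-suc p q) k) (mul[1-X]-mul[1+X] (T₊ p q) k)

T₋-suc : ∀ p q → T₋ (suc p) q ≗ mul[1+X] (T₋ p q)
T₋-suc p zero    k       = refl
T₋-suc p (suc q) zero    = trans (cong -_ (trans (mul[1-X]-cong (T₋-suc p q) 0) (mul[1-X]-mul[1+X] (T₋ p q) 0)))
  (solution (mul[1-X] (T₋ p q) 0))
  where
  solution : ∀ x → - (x + 0ℚ) ≡ - x + 0ℚ
  solution = solve-∀ ℚ-ring
T₋-suc p (suc q) (suc k) = trans (cong -_ (trans (mul[1-X]-cong (T₋-suc p q) (suc k)) (mul[1-X]-mul[1+X] (T₋ p q) (suc k))))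
  (neg-distrib-+ (mul[1-X] (T₋ p q) (suc k)) (mul[1-X] (T₋ p q) k))

T-average : ∀ p q k → T p q k ≡ ½ * T₊ p q k + ½ * T₋ p q k
T-average p zero          k = halves ([1+X]^ p) k
  where
  halves : ∀ (c : Series) k → c k ≡ ½ * c k + ½ * c k
  halves c k = solution (c k)
    where
    solution : ∀ x → x ≡ ½ * x + ½ * x
    solution = solve-∀ ℚ-ring
T-average p (suc zero)    k = cancel (mul[1-X] ([1+X]^ p) k)
  where
  cancel : ∀ x → 0ℚ ≡ ½ * x + ½ * (- x)
  cancel = solve-∀ ℚ-ring
T-average p (suc (suc q)) k = begin
  mul[1-X] (mul[1-X] (T p q)) k
    ≡⟨ mul[1-X]-cong (λ i → trans (mul[1-X]-cong (T-average p q) i) (mul[1-X]-linear ½ ½ (T₊ p q) (T₋ p q) i)) k ⟩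
  mul[1-X] (λ i → ½ * mul[1-X] (T₊ p q) i + ½ * mul[1-X] (T₋ p q) i) k
    ≡⟨ mul[1-X]-linear ½ ½ (mul[1-X] (T₊ p q)) (mul[1-X] (T₋ p q)) k ⟩
  ½ * T₊ p (suc (suc q)) k + ½ * mul[1-X] (mul[1-X] (T₋ p q)) k
    ≡⟨ cong (λ u → ½ * T₊ p (suc (suc q)) k + ½ * u) (trans (cong -_ (mul[1-X]-neg (mul[1-X] (T₋ p q)) k)) (involution (mul[1-X] (mul[1-X] (T₋ p q)) k))) ⟨
  ½ * T₊ p (suc (suc q)) k + ½ * T₋ p (suc (suc q)) k ∎
  where
  involution : ∀ x → - (- x) ≡ x
  involution = solve-∀ ℚ-ring

T-supported : ∀ p q → Supported (p ℕ.+ q) (T p q)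
T-supported p zero          = subst (λ d → Supported d ([1+X]^ p)) (sym (ℕ.+-identityʳ p)) ([1+X]^-supported p)
T-supported p (suc zero)    _ = refl
T-supported p (suc (suc q)) = subst (λ d → Supported d (T p (suc (suc q)))) (sym (trans (ℕ.+-suc p (suc q)) (cong suc (ℕ.+-suc p q))))
  (mul[1-X]-supported {c = mul[1-X] (T p q)} (mul[1-X]-supported {c = T p q} (T-supported p q)))

leibniz-scale : ∀ a U n → leibniz (λ p q → a * U p q) n ≡ a * leibniz U n
leibniz-scale a U n = trans (leibniz-cong n λ p q → pad a (U p q)) (trans (leibniz-linear a 0ℚ U U n) (sym (pad a (leibniz U n))))
  where
  pad : ∀ a x → a * x ≡ a * x + 0ℚ * x
  pad = solve-∀ ℚ-ring

2^_ : ℕ → ℚ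
2^ n = fromℕ 2 ^ n

leibniz-T₊ : ∀ n k → leibniz (λ p q → T₊ p q k) n ≡ 2^ n * δ 0 k
leibniz-T₊ zero    k = sym (*-identityˡ (δ 0 k))
leibniz-T₊ (suc n) k = begin
  leibniz (λ p q → T₊ (suc p) q k) n + leibniz (λ p q → T₊ p (suc q) k) n
    ≡⟨ leibniz-+ (λ p q → T₊ (suc p) q k) (λ p q → T₊ p (suc q) k) n ⟨
  leibniz (λ p q → T₊ (suc p) q k + T₊ p (suc q) k) n
    ≡⟨ leibniz-cong n (λ p q → trans (cong (_+ T₊ p (suc q) k) (T₊-suc p q k)) (double (T₊ p q k) (mulX (T₊ p q) k))) ⟩
  leibniz (λ p q → fromℕ 2 * T₊ p q k) n
    ≡⟨ leibniz-scale (fromℕ 2) (λ p q → T₊ p q k) n ⟩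
  fromℕ 2 * leibniz (λ p q → T₊ p q k) n
    ≡⟨ cong (fromℕ 2 *_) (leibniz-T₊ n k) ⟩
  fromℕ 2 * (2^ n * δ 0 k)
    ≡⟨ *-assoc (fromℕ 2) (2^ n) (δ 0 k) ⟨
  2^ (suc n) * δ 0 k ∎
  where
  double : ∀ x y → x + y + (x - y) ≡ fromℕ 2 * x
  double = solve-∀ ℚ-ring

leibniz-T₋ : ∀ n k → leibniz (λ p q → T₋ p q k) n ≡ 2^ n * δ n k
leibniz-T₋ zero    k = sym (*-identityˡ (δ 0 k))
leibniz-T₋ (suc n) k = begin
  leibniz (λ p q → T₋ (suc p) q k) n + leibniz (λ p q → T₋ p (suc q) k) n
    ≡⟨ leibniz-+ (λ p q → T₋ (suc p) q k) (λ p q → T₋ p (suc q) k) n ⟨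
  leibniz (λ p q → T₋ (suc p) q k + T₋ p (suc q) k) n
    ≡⟨ leibniz-cong n (λ p q → trans (cong (_+ T₋ p (suc q) k) (T₋-suc p q k)) (double (T₋ p q k) (mulX (T₋ p q) k))) ⟩
  leibniz (λ p q → fromℕ 2 * mulX (T₋ p q) k) n
    ≡⟨ leibniz-scale (fromℕ 2) (λ p q → mulX (T₋ p q) k) n ⟩
  fromℕ 2 * leibniz (λ p q → mulX (T₋ p q) k) n
    ≡⟨ cong (fromℕ 2 *_) (shifted k) ⟩
  fromℕ 2 * (2^ n * δ (suc n) k)
    ≡⟨ *-assoc (fromℕ 2) (2^ n) (δ (suc n) k) ⟨
  2^ (suc n) * δ (suc n) k ∎
  where
  double : ∀ x y → x + y + (- (x - y)) ≡ fromℕ 2 * y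
  double = solve-∀ ℚ-ring
  shifted : ∀ k → leibniz (λ p q → mulX (T₋ p q) k) n ≡ 2^ n * δ (suc n) k
  shifted zero    = trans (leibniz-zero n) (sym (*-zeroʳ (2^ n)))
  shifted (suc k) = leibniz-T₋ n k

-- (1 + x) + (1 - x) = 2 and (1 + x) - (1 - x) = 2x, so this is the average of
-- two instances of the binomial theorem.
leibniz-T : ∀ n k → leibniz (λ p q → T p q k) n ≡ ½ * 2^ n * δ 0 k + ½ * 2^ n * δ n k
leibniz-T n k = begin
  leibniz (λ p q → T p q k) n
    ≡⟨ leibniz-cong n (λ p q → T-average p q k) ⟩
  leibniz (λ p q → ½ * T₊ p q k + ½ * T₋ p q k) n
    ≡⟨ leibniz-linear ½ ½ (λ p q → T₊ p q k) (λ p q → T₋ p q k) n ⟩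
  ½ * leibniz (λ p q → T₊ p q k) n + ½ * leibniz (λ p q → T₋ p q k) n
    ≡⟨ cong₂ (λ u v → ½ * u + ½ * v) (leibniz-T₊ n k) (leibniz-T₋ n k) ⟩
  ½ * (2^ n * δ 0 k) + ½ * (2^ n * δ n k)
    ≡⟨ cong₂ _+_ (*-assoc ½ (2^ n) (δ 0 k)) (*-assoc ½ (2^ n) (δ n k)) ⟨
  ½ * 2^ n * δ 0 k + ½ * 2^ n * δ n k ∎

-- The normalisation of the first row of `M`, extended to every index: a factor (1 - x)² now changes
-- only the sign.
Φ : ℕ → Series → ℚ
Φ d c = R d c * ½ ^ ⌊ d /2⌋

-- The family `Ψ` is general because the induction passes to `Ψ ∘ suc`: each Pascal step raises the
-- index by one.
additive-leibniz : (Ψ : ℕ → Series → ℚ) → (∀ d f g → Ψ d (f ⊕ g) ≡ Ψ d f + Ψ d g) → ∀ (U : ℕ → ℕ → Series) n →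
  Ψ n (λ k → leibniz (λ p q → U p q k) n) ≡ leibniz (λ p q → Ψ (p ℕ.+ q) (U p q)) n
additive-leibniz Ψ additive U zero    = refl
additive-leibniz Ψ additive U (suc n) = begin
  Ψ (suc n) (λ k → leibniz (λ p q → U (suc p) q k) n + leibniz (λ p q → U p (suc q) k) n)
    ≡⟨ additive (suc n) _ _ ⟩
  Ψ (suc n) (λ k → leibniz (λ p q → U (suc p) q k) n) + Ψ (suc n) (λ k → leibniz (λ p q → U p (suc q) k) n)
    ≡⟨ cong₂ _+_ (additive-leibniz (Ψ ∘ suc) (additive ∘ suc) (λ p q → U (suc p) q) n)
                 (additive-leibniz (Ψ ∘ suc) (additive ∘ suc) (λ p q → U p (suc q)) n) ⟩
  leibniz (λ p q → Ψ (suc (p ℕ.+ q)) (U (suc p) q)) n + leibniz (λ p q → Ψ (suc (p ℕ.+ q)) (U p (suc q))) n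
    ≡⟨ cong (leibniz (λ p q → Ψ (suc (p ℕ.+ q)) (U (suc p) q)) n +_)
         (leibniz-cong n (λ p q → cong (λ d → Ψ d (U p (suc q))) (sym (ℕ.+-suc p q)))) ⟩
  leibniz (λ p q → Ψ (suc (p ℕ.+ q)) (U (suc p) q)) n + leibniz (λ p q → Ψ (p ℕ.+ suc q) (U p (suc q))) n ∎

Φ-additive : ∀ d f g → Φ d (f ⊕ g) ≡ Φ d f + Φ d g
Φ-additive d f g = trans
  (cong (_* h) (trans (R-cong d λ k → cong₂ _+_ (sym (*-identityˡ (f k))) (sym (*-identityˡ (g k)))) (R-linear d 1ℚ 1ℚ f g)))
  (expand (R d f) (R d g) h)
  where
  h : ℚ
  h = ½ ^ ⌊ d /2⌋
  expand : ∀ x y h → (1ℚ * x + 1ℚ * y) * h ≡ x * h + y * h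
  expand = solve-∀ ℚ-ring

moment : Series
moment j = Φ j ([1+X]^ j)

-- As functions of q, both sides satisfy u (q+2) = - u q and vanish at q = 1.
Φ-T : ∀ p q → Φ (p ℕ.+ q) (T p q) ≡ moment p * cosᴴ q
Φ-T p zero          = trans (cong (λ d → Φ d ([1+X]^ p)) (ℕ.+-identityʳ p)) (sym (*-identityʳ (moment p)))
Φ-T p (suc zero)    = trans (cong (_* ½ ^ ⌊ p ℕ.+ 1 /2⌋) (R-zero (p ℕ.+ 1) {T p 1} λ _ → refl))
  (trans (*-zeroˡ (½ ^ ⌊ p ℕ.+ 1 /2⌋)) (sym (*-zeroʳ (moment p))))
Φ-T p (suc (suc q)) = begin
  Φ (p ℕ.+ suc (suc q)) (T p (suc (suc q)))
    ≡⟨ cong (λ d → Φ d (T p (suc (suc q)))) (trans (ℕ.+-suc p (suc q)) (cong suc (ℕ.+-suc p q))) ⟩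
  R (suc (suc (p ℕ.+ q))) (mul[1-X] (mul[1-X] (T p q))) * (½ * h)
    ≡⟨ cong (_* (½ * h)) (R-mul[1-X]² (p ℕ.+ q) (T p q) (T-supported p q)) ⟩
  - fromℕ 2 * R (p ℕ.+ q) (T p q) * (½ * h)
    ≡⟨ simplify (R (p ℕ.+ q) (T p q)) h ⟩
  - Φ (p ℕ.+ q) (T p q)
    ≡⟨ cong -_ (Φ-T p q) ⟩
  - (moment p * cosᴴ q)
    ≡⟨ neg-distribʳ-* (moment p) (cosᴴ q) ⟩
  moment p * - cosᴴ q
    ≡⟨ cong (moment p *_) (neg-/1 (cosDeriv q)) ⟨
  moment p * cosᴴ (suc (suc q)) ∎
  where
  h : ℚ
  h = ½ ^ ⌊ p ℕ.+ q /2⌋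
  simplify : ∀ r h → - fromℕ 2 * r * (½ * h) ≡ - (r * h)
  simplify = solve-∀ ℚ-ring

-- The values are 1, 1, 0, 0, ...: in index 0 the two monomials coincide and ½ (1 + 1) = 1, in index
-- 1 the constant term of 1 + x is taken, and from index 2 on `R-1+x^d` applies.
Φ-1+x^n : ∀ n → Φ n (λ k → ½ * 2^ n * δ 0 k + ½ * 2^ n * δ n k) ≡ 1+x n
Φ-1+x^n zero          = refl
Φ-1+x^n (suc zero)    = refl
Φ-1+x^n (suc (suc n)) = trans (cong (_* ½ ^ ⌊ suc (suc n) /2⌋) (begin
  R (suc (suc n)) (λ k → a * δ 0 k + a * δ (suc (suc n)) k)
    ≡⟨ R-cong (suc (suc n)) (λ k → sym (*-distribˡ-+ a (δ 0 k) (δ (suc (suc n)) k))) ⟩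
  R (suc (suc n)) (λ k → a * (δ 0 k + δ (suc (suc n)) k))
    ≡⟨ R-scale (suc (suc n)) a (λ k → δ 0 k + δ (suc (suc n)) k) ⟩
  a * R (suc (suc n)) (λ k → δ 0 k + δ (suc (suc n)) k)
    ≡⟨ cong (a *_) (R-1+x^d n) ⟩
  a * 0ℚ
    ≡⟨ *-zeroʳ a ⟩
  0ℚ ∎)) (*-zeroˡ (½ ^ ⌊ suc (suc n) /2⌋))
  where
  a : ℚ
  a = ½ * 2^ (suc (suc n))

moment⊛cosᴴ : moment ⊛ cosᴴ ≗ 1+x
moment⊛cosᴴ n = begin
  leibniz (λ p q → moment p * cosᴴ q) n
    ≡⟨ leibniz-cong n Φ-T ⟨
  leibniz (λ p q → Φ (p ℕ.+ q) (T p q)) n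
    ≡⟨ additive-leibniz Φ Φ-additive T n ⟨
  Φ n (λ k → leibniz (λ p q → T p q k) n)
    ≡⟨ cong (_* ½ ^ ⌊ n /2⌋) (R-cong n (leibniz-T n)) ⟩
  Φ n (λ k → ½ * 2^ n * δ 0 k + ½ * 2^ n * δ n k)
    ≡⟨ Φ-1+x^n n ⟩
  1+x n ∎

moment≗F : moment ≗ F
moment≗F = ≗-trans (divide-cosᴴ (≗-trans (⊛-comm cosᴴ moment) moment⊛cosᴴ)) (≗-sym (divide-cosᴴ cosᴴ⊛F))

-- The other rows of the matrix

X^_[1+X]^_ : ℕ → ℕ → Series
X^ zero  [1+X]^ j = [1+X]^ j
X^ suc i [1+X]^ j = mulX (X^ i [1+X]^ j)

X^[1+X]^-supported : ∀ i j → Supported (2 ℕ.* i ℕ.+ j) (X^ i [1+X]^ j)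
X^[1+X]^-supported zero    j = [1+X]^-supported j
X^[1+X]^-supported (suc i) j {k} d<k = mulX-supported {2 ℕ.* i ℕ.+ j} {X^ i [1+X]^ j} (X^[1+X]^-supported i j)
  (ℕ.<-trans (ℕ.n<1+n _) (subst (ℕ._< k) (2*suc+ i j) d<k))

X^[1+X]^-relation : ∀ i j k → (X^ i [1+X]^ suc (suc j)) k ≡
  1ℚ * mul[1-X] (mul[1-X] (X^ i [1+X]^ j)) k + fromℕ 4 * (X^ suc i [1+X]^ j) k
X^[1+X]^-relation zero    j zero    = solution (([1+X]^ j) 0)
  where
  solution : ∀ x → x + 0ℚ + 0ℚ ≡ 1ℚ * (x - 0ℚ - 0ℚ) + fromℕ 4 * 0ℚ
  solution = solve-∀ ℚ-ring
X^[1+X]^-relation zero    j (suc k) = solution (([1+X]^ j) (suc k)) (([1+X]^ j) k) (mulX ([1+X]^ j) k)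
  where
  solution : ∀ x y z → x + y + (y + z) ≡ 1ℚ * (x - y - (y - z)) + fromℕ 4 * y
  solution = solve-∀ ℚ-ring
X^[1+X]^-relation (suc i) j zero    = refl
X^[1+X]^-relation (suc i) j (suc k) = trans (X^[1+X]^-relation i j k)
  (cong (λ u → 1ℚ * u + fromℕ 4 * (X^ suc i [1+X]^ j) k)
    (cong (λ u → mul[1-X] (X^ i [1+X]^ j) k - u) (sym (mul[1-X]-mulX (X^ i [1+X]^ j) k))))

row : ℕ → Series
row i j = R (2 ℕ.* i ℕ.+ j) (X^ i [1+X]^ j) * ½ ^ ⌊ j /2⌋

row-recurrence : ∀ i j → row (suc i) j ≡ ½ * row i j + ½ * row i (suc (suc j))
row-recurrence i j = begin
  R (2 ℕ.* suc i ℕ.+ j) q * h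
    ≡⟨ cong (λ e → R e q * h) (2*suc+ i j) ⟩
  R (2+ d) q * h
    -- The later steps replace the inner bracket by R of x^i (1 + x)^(j+2). The factor ½ next to h
    -- is due to ⌊(j+2)/2⌋.
    ≡⟨ solution (R d c) (R (2+ d) q) h ⟩
  ½ * (R d c * h) + ½ * ((1ℚ * (- fromℕ 2 * R d c) + fromℕ 4 * R (2+ d) q) * (½ * h))
    ≡⟨ cong (λ u → ½ * (R d c * h) + ½ * ((1ℚ * u + fromℕ 4 * R (2+ d) q) * (½ * h))) (R-mul[1-X]² d c (X^[1+X]^-supported i j)) ⟨
  ½ * (R d c * h) + ½ * ((1ℚ * R (2+ d) (mul[1-X] (mul[1-X] c)) + fromℕ 4 * R (2+ d) q) * (½ * h))
    ≡⟨ cong (λ u → ½ * (R d c * h) + ½ * (u * (½ * h))) (R-linear (2+ d) 1ℚ (fromℕ 4) (mul[1-X] (mul[1-X] c)) q) ⟨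
  ½ * (R d c * h) + ½ * (R (2+ d) (λ k → 1ℚ * mul[1-X] (mul[1-X] c) k + fromℕ 4 * q k) * (½ * h))
    ≡⟨ cong (λ u → ½ * (R d c * h) + ½ * (u * (½ * h))) (R-cong (2+ d) (X^[1+X]^-relation i j)) ⟨
  ½ * (R d c * h) + ½ * (R (2+ d) (X^ i [1+X]^ suc (suc j)) * (½ * h))
    ≡⟨ cong (λ e → ½ * (R d c * h) + ½ * (R e (X^ i [1+X]^ suc (suc j)) * (½ * h))) (2*+suc² i j) ⟨
  ½ * (R d c * h) + ½ * (R (2 ℕ.* i ℕ.+ suc (suc j)) (X^ i [1+X]^ suc (suc j)) * (½ * h)) ∎
  where
  d : ℕ
  d = 2 ℕ.* i ℕ.+ j
  2+ : ℕ → ℕ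
  2+ n = suc (suc n)
  c q : Series
  c = X^ i [1+X]^ j
  q = X^ suc i [1+X]^ j
  h : ℚ
  h = ½ ^ ⌊ j /2⌋
  solution : ∀ r s h → s * h ≡ ½ * (r * h) + ½ * ((1ℚ * (- fromℕ 2 * r) + fromℕ 4 * s) * (½ * h))
  solution = solve-∀ ℚ-ring

det-row : ∀ N → det {N} (λ i j → row (toℕ i) (toℕ j)) ≡ ∏ N (λ i → ∏ i (λ _ → ½ * 1ℚ)) * dilatedHankel N (1+x ÷ˢ cos)
det-row N = det-leads {N} row hankelEntry _
  -- Dilated Hankel rows are double shifts of each other, so their pivots are 1 and each step of the
  -- recurrence contributes only its coefficient ½.
  (shift₂-orbit {hankelEntry} {λ _ → 1ℚ} step ½ ½ row moment≗F row-recurrence)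
  where
  step : ∀ k → Leads hankelEntry (suc k) 1ℚ (shift₂ (hankelEntry k))
  step k = leads (Span-zero (suc k)) λ j → trans (cong F (trans (2*+suc² k j) (sym (2*suc+ k j)))) (pad (hankelEntry (suc k) j))
    where
    pad : ∀ x → x ≡ 1ℚ * x + 0ℚ
    pad = solve-∀ ℚ-ring

-- Coefficient lists

coeff : Poly → Series
coeff []      k       = 0ℚ
coeff (a ∷ p) zero    = a
coeff (a ∷ p) (suc k) = coeff p k

coeff-+ᵖ : ∀ p q k → coeff (p +ᵖ q) k ≡ coeff p k + coeff q k
coeff-+ᵖ []      q       k       = sym (+-identityˡ (coeff q k))
coeff-+ᵖ (a ∷ p) []      k       = sym (+-identityʳ (coeff (a ∷ p) k))
coeff-+ᵖ (a ∷ p) (b ∷ q) zero    = refl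
coeff-+ᵖ (a ∷ p) (b ∷ q) (suc k) = coeff-+ᵖ p q k

coeff-·ᵖ : ∀ c p k → coeff (c ·ᵖ p) k ≡ c * coeff p k
coeff-·ᵖ c []      k       = sym (*-zeroʳ c)
coeff-·ᵖ c (a ∷ p) zero    = refl
coeff-·ᵖ c (a ∷ p) (suc k) = coeff-·ᵖ c p k

coeff-*ᵖ : ∀ p q → coeff (p *ᵖ q) ≗ cauchy (coeff p) (coeff q)
coeff-*ᵖ []      q zero    = sym (*-zeroˡ (coeff q 0))
coeff-*ᵖ []      q (suc k) = trans (coeff-*ᵖ [] q k) (sym (trans (cong (_+ cauchy (coeff []) (coeff q) k) (*-zeroˡ (coeff q (suc k)))) (+-identityˡ _)))
coeff-*ᵖ (a ∷ p) q k = trans (coeff-+ᵖ (a ·ᵖ q) (0ℚ ∷ p *ᵖ q) k)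
  (trans (cong (_+ coeff (0ℚ ∷ p *ᵖ q) k) (coeff-·ᵖ a q k)) (step k))
  where
  step : ∀ k → a * coeff q k + coeff (0ℚ ∷ p *ᵖ q) k ≡ cauchy (coeff (a ∷ p)) (coeff q) k
  step zero    = +-identityʳ (a * coeff q 0)
  step (suc k) = cong (a * coeff q (suc k) +_) (coeff-*ᵖ p q k)

coeff-oneᵖ : coeff oneᵖ ≗ δ 0
coeff-oneᵖ zero    = refl
coeff-oneᵖ (suc k) = refl

cauchy-zero : ∀ g → cauchy (λ _ → 0ℚ) g ≗ λ _ → 0ℚ
cauchy-zero g zero    = *-zeroˡ (g 0)
cauchy-zero g (suc k) = cong₂ _+_ (*-zeroˡ (g (suc k))) (cauchy-zero g k)

cauchy-identityˡ : ∀ g → cauchy (δ 0) g ≗ g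
cauchy-identityˡ g zero    = *-identityˡ (g 0)
cauchy-identityˡ g (suc k) = trans (cong₂ _+_ (*-identityˡ (g (suc k))) (cauchy-zero g k)) (+-identityʳ (g (suc k)))

cauchy-mulX : ∀ f g → cauchy (mulX f) g ≗ mulX (cauchy f g)
cauchy-mulX f g zero    = *-zeroˡ (g 0)
cauchy-mulX f g (suc k) = trans (cong (_+ cauchy f g k) (*-zeroˡ (g (suc k)))) (+-identityˡ _)

coeff-X : coeff X ≗ mulX (δ 0)
coeff-X zero    = refl
coeff-X (suc k) = coeff-oneᵖ k

coeff-X*ᵖ : ∀ q → coeff (X *ᵖ q) ≗ mulX (coeff q)
coeff-X*ᵖ q k = begin
  coeff (X *ᵖ q) k                  ≡⟨ coeff-*ᵖ X q k ⟩
  cauchy (coeff X) (coeff q) k      ≡⟨ cauchy-congˡ (coeff q) coeff-X k ⟩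
  cauchy (mulX (δ 0)) (coeff q) k   ≡⟨ cauchy-mulX (δ 0) (coeff q) k ⟩
  mulX (cauchy (δ 0) (coeff q)) k   ≡⟨ mulX-cong (cauchy-identityˡ (coeff q)) k ⟩
  mulX (coeff q) k                  ∎

coeff-X^ᵖ : ∀ d → coeff (X ^ᵖ d) ≗ δ d
coeff-X^ᵖ zero    k = coeff-oneᵖ k
coeff-X^ᵖ (suc d) k = trans (coeff-X*ᵖ (X ^ᵖ d) k) (trans (mulX-cong (coeff-X^ᵖ d) k) (mulX-δ d k))

coeff-[1+X]^ᵖ : ∀ j → coeff ((oneᵖ +ᵖ X) ^ᵖ j) ≗ [1+X]^ j
coeff-[1+X]^ᵖ zero    k = coeff-oneᵖ k
coeff-[1+X]^ᵖ (suc j) k = begin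
  coeff ((oneᵖ +ᵖ X) *ᵖ q) k
    ≡⟨ coeff-*ᵖ (oneᵖ +ᵖ X) q k ⟩
  cauchy (coeff (oneᵖ +ᵖ X)) (coeff q) k
    ≡⟨ cauchy-congˡ (coeff q) (λ i → trans (coeff-+ᵖ oneᵖ X i) (cong₂ _+_ (coeff-oneᵖ i) (coeff-X i))) k ⟩
  cauchy (δ 0 ⊕ mulX (δ 0)) (coeff q) k
    ≡⟨ cauchy-+ˡ (δ 0) (mulX (δ 0)) (coeff q) k ⟩
  cauchy (δ 0) (coeff q) k + cauchy (mulX (δ 0)) (coeff q) k
    ≡⟨ cong₂ _+_ (cauchy-identityˡ (coeff q) k) (trans (cauchy-mulX (δ 0) (coeff q) k) (mulX-cong (cauchy-identityˡ (coeff q)) k)) ⟩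
  mul[1+X] (coeff q) k
    ≡⟨ mul[1+X]-cong (coeff-[1+X]^ᵖ j) k ⟩
  mul[1+X] ([1+X]^ j) k ∎
  where
  q : Poly
  q = (oneᵖ +ᵖ X) ^ᵖ j

coeff-X^[1+X]^ : ∀ i j → coeff (X ^ᵖ i *ᵖ (oneᵖ +ᵖ X) ^ᵖ j) ≗ X^ i [1+X]^ j
coeff-X^[1+X]^ i j k = trans (coeff-*ᵖ (X ^ᵖ i) q k) (trans (cauchy-congˡ (coeff q) (coeff-X^ᵖ i) k) (shifted i k))
  where
  q : Poly
  q = (oneᵖ +ᵖ X) ^ᵖ j
  shifted : ∀ i → cauchy (δ i) (coeff q) ≗ X^ i [1+X]^ j
  shifted zero    k = trans (cauchy-identityˡ (coeff q) k) (coeff-[1+X]^ᵖ j k)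
  shifted (suc i) k = trans (cauchy-congˡ (coeff q) (λ l → sym (mulX-δ i l)) k)
    (trans (cauchy-mulX (δ i) (coeff q) k) (mulX-cong (shifted i) k))

eval-zero : ∀ p c → (∀ k → coeff p k ≡ 0ℚ) → eval p c ≡ 0ℚ
eval-zero []      c p≗0 = refl
eval-zero (a ∷ p) c p≗0 = trans (cong₂ (λ u v → u + c * v) (p≗0 0) (eval-zero p c (p≗0 ∘ suc))) (simplify c)
  where
  simplify : ∀ c → 0ℚ + c * 0ℚ ≡ 0ℚ
  simplify = solve-∀ ℚ-ring

partialSum-suc : ∀ c k → partialSum c (suc k) ≡ c 0 + partialSum (c ∘ suc) k
partialSum-suc c zero    = refl
partialSum-suc c (suc k) = trans (cong (_+ c (suc (suc k))) (partialSum-suc c k)) (+-assoc (c 0) (partialSum (c ∘ suc) k) (c (suc (suc k))))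

-- In synthetic division at 1, coefficient k of the quotient is the sum of the coefficients of `p`
-- beyond k.
coeff-divLinear : ∀ p k → coeff (divLinear 1ℚ p) k ≡ eval p 1ℚ - partialSum (coeff p) k
coeff-divLinear []      k       = sym (trans (cong (λ u → 0ℚ - u) (partialSum-[] k)) refl)
  where
  partialSum-[] : ∀ k → partialSum (coeff []) k ≡ 0ℚ
  partialSum-[] zero    = refl
  partialSum-[] (suc k) = trans (+-identityʳ (partialSum (coeff []) k)) (partialSum-[] k)
coeff-divLinear (a ∷ p) zero    = solution a (eval p 1ℚ)
  where
  solution : ∀ a e → e ≡ a + 1ℚ * e - a
  solution = solve-∀ ℚ-ring
coeff-divLinear (a ∷ p) (suc k) = trans (coeff-divLinear p k)
  (trans (solution a (eval p 1ℚ) (partialSum (coeff p) k)) (cong (λ u → a + 1ℚ * eval p 1ℚ - u) (sym (partialSum-suc (coeff (a ∷ p)) k))))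
  where
  solution : ∀ a e s → e - s ≡ a + 1ℚ * e - (a + s)
  solution = solve-∀ ℚ-ring

coeff-divLinear-beyond : ∀ p d → Supported d (coeff p) → coeff (divLinear 1ℚ p) d ≡ 0ℚ
coeff-divLinear-beyond []      d       supp = refl
coeff-divLinear-beyond (a ∷ p) zero    supp = eval-zero p 1ℚ λ k → supp (s≤s z≤n)
coeff-divLinear-beyond (a ∷ p) (suc d) supp = coeff-divLinear-beyond p d λ d<k → supp (s≤s d<k)

-- The quotient by x - 1 has coefficient 0 in degree d, and by `coeff-divLinear` this coefficient is
-- the difference of the two sides.
eval-one : ∀ p d → Supported d (coeff p) → eval p 1ℚ ≡ partialSum (coeff p) d
eval-one p d supp = begin
  eval p 1ℚ                                                               ≡⟨ solution (eval p 1ℚ) (partialSum (coeff p) d) ⟩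
  eval p 1ℚ - partialSum (coeff p) d + partialSum (coeff p) d             ≡⟨ cong (_+ partialSum (coeff p) d) (trans (sym (coeff-divLinear p d)) (coeff-divLinear-beyond p d supp)) ⟩
  0ℚ + partialSum (coeff p) d                                             ≡⟨ +-identityˡ _ ⟩
  partialSum (coeff p) d                                                  ∎
  where
  solution : ∀ x y → x ≡ x - y + y
  solution = solve-∀ ℚ-ring

-- Palindromic coefficient sequences

-- Used for the signs s = 1 and s = - 1.
record Palindromic (s : ℚ) (d : ℕ) (c : Series) : Set where
  constructor palindromic
  field
    supported : Supported d c
    reflect   : ∀ i j → i ℕ.+ j ≡ d → c i ≡ s * c j

open Palindromic

Palindromic-resp-≗ : ∀ {s d f g} → f ≗ g → Palindromic s d f → Palindromic s d g
Palindromic-resp-≗ {s} f≗g pal = palindromic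
  (λ d<k → trans (sym (f≗g _)) (supported pal d<k))
  (λ i j eq → trans (sym (f≗g i)) (trans (reflect pal i j eq) (cong (s *_) (f≗g j))))

-- Reflection turns s times the lowest j+1 coefficients into the highest ones, so the two sums
-- together cover all of `c`. The induction moves one coefficient at a time from the second sum to
-- the first.
partialSum-reflect : ∀ {s d c} → Palindromic s (suc d) c → ∀ i j → i ℕ.+ j ≡ d →
  partialSum c i + s * partialSum c j ≡ partialSum c (suc d)
partialSum-reflect {s} {d} {c} pal i zero    eq with refl ← trans (sym (ℕ.+-identityʳ i)) eq =
  cong (partialSum c i +_) (sym (reflect pal (suc i) 0 (cong suc (ℕ.+-identityʳ i))))
partialSum-reflect {s} {d} {c} pal i (suc j) eq = begin
  partialSum c i + s * (partialSum c j + c (suc j))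
    ≡⟨ regroup (partialSum c i) s (partialSum c j) (c (suc j)) ⟩
  partialSum c i + s * c (suc j) + s * partialSum c j
    ≡⟨ cong (λ u → partialSum c i + u + s * partialSum c j) (reflect pal (suc i) (suc j) (cong suc eq)) ⟨
  partialSum c (suc i) + s * partialSum c j
    ≡⟨ partialSum-reflect pal (suc i) j (trans (sym (ℕ.+-suc i j)) eq) ⟩
  partialSum c (suc d) ∎
  where
  regroup : ∀ x s y z → x + s * (y + z) ≡ x + s * z + s * y
  regroup = solve-∀ ℚ-ring

partialSum-beyond : ∀ {d c} → Supported d c → ∀ k → d ℕ.≤ k → partialSum c k ≡ partialSum c d
partialSum-beyond {d} {c} supp k d≤k = subst (λ m → partialSum c m ≡ partialSum c d) (ℕ.m∸n+n≡m d≤k) (go (k ℕ.∸ d))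
  where
  go : ∀ e → partialSum c (e ℕ.+ d) ≡ partialSum c d
  go zero    = refl
  go (suc e) = trans (cong₂ _+_ (go e) (supp (s≤s (ℕ.m≤n+m d e)))) (+-identityʳ _)

-- Taking partial sums is division by 1 - x, exact when the total is 0.
partialSum-palindromic : ∀ {s d c} → Palindromic s (suc d) c → partialSum c (suc d) ≡ 0ℚ → Palindromic (- s) d (partialSum c)
partialSum-palindromic {s} {d} {c} pal total = palindromic
  (λ d<k → trans (partialSum-beyond {c = c} (supported pal) _ d<k) total)
  (λ i j eq → begin
    partialSum c i
      ≡⟨ solution (partialSum c i) s (partialSum c j) ⟩
    partialSum c i + s * partialSum c j + - s * partialSum c j
      ≡⟨ cong (_+ - s * partialSum c j) (trans (partialSum-reflect pal i j eq) total) ⟩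
    0ℚ + - s * partialSum c j
      ≡⟨ +-identityˡ _ ⟩
    - s * partialSum c j ∎)
  where
  solution : ∀ x s y → x ≡ x + s * y + - s * y
  solution = solve-∀ ℚ-ring

-- Complementary partial sums, taken in either order, give t = a - b and t = b - a. This supplies
-- the second zero at 1 of the numerator, whose quotient by 1 - x is antipalindromic.
antipalindromic-total : ∀ {d c} → Palindromic (- 1ℚ) (suc d) c → partialSum c (suc d) ≡ 0ℚ
antipalindromic-total {d} {c} pal = begin
  t                   ≡⟨ halve t ⟩
  ½ * (t + t)         ≡⟨ cong (½ *_) (cong₂ _+_ (partialSum-reflect pal 0 d refl) (partialSum-reflect pal d 0 (ℕ.+-identityʳ d))) ⟨
  ½ * (a + - 1ℚ * b + (b + - 1ℚ * a)) ≡⟨ cancel a b ⟩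
  0ℚ                  ∎
  where
  t a b : ℚ
  t = partialSum c (suc d)
  a = partialSum c 0
  b = partialSum c d
  halve : ∀ x → x ≡ ½ * (x + x)
  halve = solve-∀ ℚ-ring
  cancel : ∀ a b → ½ * (a + - 1ℚ * b + (b + - 1ℚ * a)) ≡ 0ℚ
  cancel = solve-∀ ℚ-ring

δ-reflect : ∀ d i j → i ℕ.+ j ≡ d → δ d i ≡ δ 0 j
δ-reflect d       zero    j refl = δ-sym d 0
δ-reflect (suc d) (suc i) j eq   = δ-reflect d i j (ℕ.suc-injective eq)

numerator-palindromic : ∀ {d c} → Palindromic 1ℚ d c → Palindromic 1ℚ d (numerator d c)
numerator-palindromic {d} {c} pal = palindromic
  (λ {k} d<k → trans
    (cong₂ (λ u v → partialSum c d * u + - 1ℚ * (fromℕ 2 * v)) (cong₂ _+_ (δ-upper d<k) (δ-upper (ℕ.≤-<-trans z≤n d<k))) (supported pal d<k))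
    (annihilate (partialSum c d)))
  (λ i j eq → trans
    (cong₂ (λ u v → partialSum c d * u + - 1ℚ * (fromℕ 2 * v))
      (trans (cong₂ _+_ (δ-reflect d i j eq) (sym (δ-reflect d j i (trans (ℕ.+-comm j i) eq)))) (+-comm (δ 0 j) (δ d j)))
      (reflect pal i j eq))
    (unit (partialSum c d) (δ d j + δ 0 j) (c j)))
  where
  annihilate : ∀ t → t * (0ℚ + 0ℚ) + - 1ℚ * (fromℕ 2 * 0ℚ) ≡ 0ℚ
  annihilate = solve-∀ ℚ-ring
  unit : ∀ t e x → t * e + - 1ℚ * (fromℕ 2 * (1ℚ * x)) ≡ 1ℚ * (t * e + - 1ℚ * (fromℕ 2 * x))
  unit = solve-∀ ℚ-ring

numerator-total : ∀ d c → partialSum (numerator d c) d ≡ 0ℚ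
numerator-total d c = begin
  partialSum (numerator d c) d
    ≡⟨ partialSum-cong (λ k → regroup t (δ d k) (δ 0 k) (c k)) d ⟩
  partialSum (λ k → t * (1ℚ * δ d k + 1ℚ * δ 0 k) + - fromℕ 2 * c k) d
    ≡⟨ partialSum-linear t (- fromℕ 2) (λ k → 1ℚ * δ d k + 1ℚ * δ 0 k) c d ⟩
  t * partialSum (λ k → 1ℚ * δ d k + 1ℚ * δ 0 k) d + - fromℕ 2 * t
    ≡⟨ cong (λ u → t * u + - fromℕ 2 * t) (trans (partialSum-linear 1ℚ 1ℚ (δ d) (δ 0) d)
         (cong₂ (λ u v → 1ℚ * u + 1ℚ * v) (partialSum-δ d) (partialSum-δ₀ d))) ⟩
  t * fromℕ 2 + - fromℕ 2 * t
    ≡⟨ cancel t ⟩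
  0ℚ ∎
  where
  t : ℚ
  t = partialSum c d
  regroup : ∀ t x y z → t * (x + y) + - 1ℚ * (fromℕ 2 * z) ≡ t * (1ℚ * x + 1ℚ * y) + - fromℕ 2 * z
  regroup = solve-∀ ℚ-ring
  cancel : ∀ t → t * fromℕ 2 + - fromℕ 2 * t ≡ 0ℚ
  cancel = solve-∀ ℚ-ring

quotient-antipalindromic : ∀ {d c} → Palindromic 1ℚ (suc d) c → Palindromic (- 1ℚ) d (partialSum (numerator (suc d) c))
quotient-antipalindromic {d} {c} pal = partialSum-palindromic (numerator-palindromic pal) (numerator-total (suc d) c)

reduce-palindromic : ∀ {d c} → Palindromic 1ℚ (suc (suc d)) c → Palindromic 1ℚ d (reduce (suc (suc d)) c)
reduce-palindromic pal = partialSum-palindromic (quotient-antipalindromic pal) (antipalindromic-total (quotient-antipalindromic pal))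

-- Partial sums divide by 1 - x, synthetic division divides by x - 1, hence the sign; it occurs
-- twice in `N₀` and cancels in `coeff-N₀`.
coeff-exact-divLinear : ∀ p d → Supported d (coeff p) → partialSum (coeff p) d ≡ 0ℚ →
  ∀ k → coeff (divLinear 1ℚ p) k ≡ - partialSum (coeff p) k
coeff-exact-divLinear p d supp total k = trans (coeff-divLinear p k)
  (trans (cong (_- partialSum (coeff p) k) (trans (eval-one p d supp) total)) (+-identityˡ _))

-- The index, and agreement of `ρ` with `R`

IsZero : Poly → Set
IsZero = All (_≡ 0ℚ)

IsZero⇒coeff : ∀ {p} → IsZero p → ∀ k → coeff p k ≡ 0ℚ
IsZero⇒coeff []           k       = refl
IsZero⇒coeff (a≡0 ∷ p≗0) zero    = a≡0
IsZero⇒coeff (a≡0 ∷ p≗0) (suc k) = IsZero⇒coeff p≗0 k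

coeff-degree : ∀ p → ¬ IsZero p → coeff p (degree p) ≢ 0ℚ
coeff-degree []      p≢0 = contradiction [] p≢0
coeff-degree (a ∷ p) p≢0 with all? (_≟ 0ℚ) p
... | yes p≗0 = λ a≡0 → p≢0 (a≡0 ∷ p≗0)
... | no  p≢0 = coeff-degree p p≢0

degree-supported : ∀ p → Supported (degree p) (coeff p)
degree-supported []      _ = refl
degree-supported (a ∷ p) d<k with all? (_≟ 0ℚ) p
degree-supported (a ∷ p) (s≤s {n = k} _) | yes p≗0 = IsZero⇒coeff p≗0 k
degree-supported (a ∷ p) (s≤s d<k)       | no  _   = degree-supported p d<k

coeff-valuation : ∀ p → ¬ IsZero p → coeff p (valuation p) ≢ 0ℚ
coeff-valuation []      p≢0 = contradiction [] p≢0
coeff-valuation (a ∷ p) p≢0 with a ≟ 0ℚ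
... | yes a≡0 = coeff-valuation p λ p≗0 → p≢0 (a≡0 ∷ p≗0)
... | no  a≢0 = a≢0

coeff-below-valuation : ∀ p k → k ℕ.< valuation p → coeff p k ≡ 0ℚ
coeff-below-valuation (a ∷ p) k k<v with a ≟ 0ℚ
coeff-below-valuation (a ∷ p) zero    k<v       | yes a≡0 = a≡0
coeff-below-valuation (a ∷ p) (suc k) (s≤s k<v) | yes a≡0 = coeff-below-valuation p k k<v

-- Reflection sends the highest nonzero coefficient to a nonzero one at d - degree, and the lowest
-- to a nonzero one at d - valuation. These bound the valuation by the former and the degree from
-- below by the latter.
index-palindromic : ∀ p d → ¬ IsZero p → Palindromic 1ℚ d (coeff p) → index p ≡ d
index-palindromic p d p≢0 pal = ℕ.≤-antisym upper lower
  where
  g v : ℕ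
  g = degree p
  v = valuation p
  within : ∀ {k} → coeff p k ≢ 0ℚ → k ℕ.≤ d
  within c≢0 = ℕ.≮⇒≥ λ d<k → c≢0 (supported pal d<k)
  mirror : ∀ {k} → coeff p k ≢ 0ℚ → coeff p (d ℕ.∸ k) ≢ 0ℚ
  mirror {k} c≢0 eq = c≢0 (trans (reflect pal k (d ℕ.∸ k) (ℕ.m+[n∸m]≡n (within c≢0))) (trans (*-identityˡ _) eq))
  g≤d : g ℕ.≤ d
  g≤d = within (coeff-degree p p≢0)
  upper : g ℕ.+ v ℕ.≤ d
  upper = subst (g ℕ.+ v ℕ.≤_) (ℕ.m+[n∸m]≡n g≤d) (ℕ.+-monoʳ-≤ g
    (ℕ.≮⇒≥ λ d-g<v → mirror (coeff-degree p p≢0) (coeff-below-valuation p (d ℕ.∸ g) d-g<v)))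
  v≤d : v ℕ.≤ d
  v≤d = within (coeff-valuation p p≢0)
  lower : d ℕ.≤ g ℕ.+ v
  lower = subst (ℕ._≤ g ℕ.+ v) (ℕ.m∸n+n≡m v≤d) (ℕ.+-monoˡ-≤ v
    (ℕ.≮⇒≥ λ g<d-v → mirror (coeff-valuation p p≢0) (degree-supported p g<d-v)))

module _ {d : ℕ} (P : Poly) (pal : Palindromic 1ℚ (suc (suc d)) (coeff P)) where

  private
    e : ℕ
    e = suc (suc d)
    T₀ : Poly
    T₀ = eval P 1ℚ ·ᵖ (X ^ᵖ index P +ᵖ oneᵖ) -ᵖ fromℕ 2 ·ᵖ P

  coeff-T₀ : ∀ k → coeff T₀ k ≡ eval P 1ℚ * (δ (index P) k + δ 0 k) + - 1ℚ * (fromℕ 2 * coeff P k)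
  coeff-T₀ k = begin
    coeff T₀ k
      ≡⟨ coeff-+ᵖ (eval P 1ℚ ·ᵖ (X ^ᵖ index P +ᵖ oneᵖ)) _ k ⟩
    coeff (eval P 1ℚ ·ᵖ (X ^ᵖ index P +ᵖ oneᵖ)) k + coeff ((- 1ℚ) ·ᵖ (fromℕ 2 ·ᵖ P)) k
      ≡⟨ cong₂ _+_ (coeff-·ᵖ (eval P 1ℚ) (X ^ᵖ index P +ᵖ oneᵖ) k) (coeff-·ᵖ (- 1ℚ) (fromℕ 2 ·ᵖ P) k) ⟩
    eval P 1ℚ * coeff (X ^ᵖ index P +ᵖ oneᵖ) k + - 1ℚ * coeff (fromℕ 2 ·ᵖ P) k
      ≡⟨ cong₂ (λ u v → eval P 1ℚ * u + - 1ℚ * v)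
           (trans (coeff-+ᵖ (X ^ᵖ index P) oneᵖ k) (cong₂ _+_ (coeff-X^ᵖ (index P) k) (coeff-oneᵖ k)))
           (coeff-·ᵖ (fromℕ 2) P k) ⟩
    eval P 1ℚ * (δ (index P) k + δ 0 k) + - 1ℚ * (fromℕ 2 * coeff P k) ∎

  -- The index computed by `N₀` is `e` unless `P` is zero, and then the factor P(1) = 0 removes the
  -- term in which it occurs.
  coeff-T₀≗numerator : coeff T₀ ≗ numerator e (coeff P)
  coeff-T₀≗numerator k with all? (_≟ 0ℚ) P
  ... | yes P≗0 = trans (coeff-T₀ k) (trans
    (cong (λ u → u * (δ (index P) k + δ 0 k) + - 1ℚ * (fromℕ 2 * coeff P k)) evalP)
    (trans (drop (δ (index P) k + δ 0 k) (δ e k + δ 0 k) (coeff P k))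
      (cong (λ u → u * (δ e k + δ 0 k) + - 1ℚ * (fromℕ 2 * coeff P k)) (trans (sym evalP) (eval-one P e (supported pal))))))
    where
    evalP : eval P 1ℚ ≡ 0ℚ
    evalP = eval-zero P 1ℚ (IsZero⇒coeff P≗0)
    drop : ∀ x y c → 0ℚ * x + - 1ℚ * (fromℕ 2 * c) ≡ 0ℚ * y + - 1ℚ * (fromℕ 2 * c)
    drop = solve-∀ ℚ-ring
  ... | no  P≢0 = trans (coeff-T₀ k) (cong₂ (λ u m → u * (δ m k + δ 0 k) + - 1ℚ * (fromℕ 2 * coeff P k))
    (eval-one P e (supported pal)) (index-palindromic P e P≢0 pal))

  coeff-N₀ : coeff (N₀ P) ≗ reduce e (coeff P)
  coeff-N₀ k = begin
    coeff (divLinear 1ℚ (divLinear 1ℚ T₀)) k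
      ≡⟨ coeff-exact-divLinear (divLinear 1ℚ T₀) (suc d) (supported U-pal) (antipalindromic-total U-pal) k ⟩
    - partialSum (coeff (divLinear 1ℚ T₀)) k
      ≡⟨ cong -_ (trans (partialSum-cong (λ i → trans (coeff-U i) (expand (partialSum (numerator e (coeff P)) i))) k)
           (partialSum-linear (- 1ℚ) 0ℚ (partialSum (numerator e (coeff P))) (partialSum (numerator e (coeff P))) k)) ⟩
    - (- 1ℚ * reduce e (coeff P) k + 0ℚ * reduce e (coeff P) k)
      ≡⟨ simplify (reduce e (coeff P) k) ⟩
    reduce e (coeff P) k ∎
    where
    expand : ∀ x → - x ≡ - 1ℚ * x + 0ℚ * x
    expand = solve-∀ ℚ-ring
    simplify : ∀ x → - (- 1ℚ * x + 0ℚ * x) ≡ x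
    simplify = solve-∀ ℚ-ring
    T₀-pal : Palindromic 1ℚ e (coeff T₀)
    T₀-pal = Palindromic-resp-≗ (λ i → sym (coeff-T₀≗numerator i)) (numerator-palindromic pal)
    coeff-U : ∀ i → coeff (divLinear 1ℚ T₀) i ≡ - partialSum (numerator e (coeff P)) i
    coeff-U i = trans
      (coeff-exact-divLinear T₀ e (supported T₀-pal) (trans (partialSum-cong coeff-T₀≗numerator e) (numerator-total e (coeff P))) i)
      (cong -_ (partialSum-cong coeff-T₀≗numerator i))
    U-pal : Palindromic (- 1ℚ) (suc d) (coeff (divLinear 1ℚ T₀))
    U-pal = palindromic
      (λ d<k → trans (coeff-U _) (cong -_ (supported (quotient-antipalindromic pal) d<k)))
      (λ i j eq → trans (coeff-U i) (trans (cong -_ (reflect (quotient-antipalindromic pal) i j eq))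
        (trans (neg-distribʳ-* (- 1ℚ) (partialSum (numerator e (coeff P)) j)) (cong (- 1ℚ *_) (sym (coeff-U j))))))

constantTerm-fold : ∀ d P → Palindromic 1ℚ d (coeff P) → constantTerm (fold P N₀ ⌊ d /2⌋) ≡ R d (coeff P)
constantTerm-fold zero          []      pal = refl
constantTerm-fold zero          (a ∷ P) pal = refl
constantTerm-fold (suc zero)    []      pal = refl
constantTerm-fold (suc zero)    (a ∷ P) pal = refl
constantTerm-fold (suc (suc d)) P       pal = begin
  constantTerm (N₀ (fold P N₀ ⌊ d /2⌋))   ≡⟨ cong constantTerm (fold-suc ⌊ d /2⌋) ⟩
  constantTerm (fold (N₀ P) N₀ ⌊ d /2⌋)   ≡⟨ constantTerm-fold d (N₀ P) (Palindromic-resp-≗ (λ k → sym (coeff-N₀ P pal k)) (reduce-palindromic pal)) ⟩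
  R d (coeff (N₀ P))                      ≡⟨ R-cong d (coeff-N₀ P pal) ⟩
  R (suc (suc d)) (coeff P)               ∎
  where
  -- `fold` puts the last `N₀` outermost, whereas `R` reduces from the inside.
  fold-suc : ∀ m → N₀ (fold P N₀ m) ≡ fold (N₀ P) N₀ m
  fold-suc zero    = refl
  fold-suc (suc m) = cong N₀ (fold-suc m)

ρ-palindromic : ∀ d P → ¬ IsZero P → Palindromic 1ℚ d (coeff P) → ρ P ≡ R d (coeff P)
ρ-palindromic d P P≢0 pal = trans
  (cong (λ m → constantTerm (fold P N₀ ⌊ m /2⌋)) (index-palindromic P d P≢0 pal))
  (constantTerm-fold d P pal)

-- Palindromicity of x^i (1 + x)^j

mulX-palindromic : ∀ {d c} → Palindromic 1ℚ d c → Palindromic 1ℚ (suc (suc d)) (mulX c)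
mulX-palindromic {d} {c} pal = palindromic
  (λ d<k → mulX-supported {c = c} (supported pal) (ℕ.<-trans (ℕ.n<1+n _) d<k))
  mulX-reflect
  where
  mulX-reflect : ∀ i j → i ℕ.+ j ≡ suc (suc d) → mulX c i ≡ 1ℚ * mulX c j
  mulX-reflect zero    (suc j) eq = sym (trans (*-identityˡ (c j)) (supported pal (ℕ.≤-reflexive (sym (ℕ.suc-injective eq)))))
  mulX-reflect (suc i) zero    eq = supported pal (ℕ.≤-reflexive (sym (ℕ.suc-injective (trans (sym (ℕ.+-identityʳ (suc i))) eq))))
  mulX-reflect (suc i) (suc j) eq = reflect pal i j (ℕ.suc-injective (trans (sym (ℕ.+-suc i j)) (ℕ.suc-injective eq)))

mul[1+X]-palindromic : ∀ {d c} → Palindromic 1ℚ d c → Palindromic 1ℚ (suc d) (mul[1+X] c)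
mul[1+X]-palindromic {d} {c} pal = palindromic (mul[1+X]-supported {c = c} (supported pal)) mul[1+X]-reflect
  where
  first : ∀ x y → x ≡ 1ℚ * y → x + 0ℚ ≡ 1ℚ * (0ℚ + y)
  first x y eq = trans (+-identityʳ x) (trans eq (cong (1ℚ *_) (sym (+-identityˡ y))))
  mul[1+X]-reflect : ∀ i j → i ℕ.+ j ≡ suc d → mul[1+X] c i ≡ 1ℚ * mul[1+X] c j
  mul[1+X]-reflect zero    (suc j) eq = trans (first (c 0) (c j) (reflect pal 0 j (ℕ.suc-injective eq)))
    (cong (λ u → 1ℚ * (u + c j)) (sym (supported pal (ℕ.≤-reflexive (sym eq)))))
  mul[1+X]-reflect (suc i) zero    eq = trans
    (cong₂ _+_ (supported pal (ℕ.≤-reflexive (sym eq′))) (reflect pal i 0 (ℕ.suc-injective eq)))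
    (last (c 0))
    where
    eq′ : suc i ≡ suc d
    eq′ = trans (sym (ℕ.+-identityʳ (suc i))) eq
    last : ∀ x → 0ℚ + 1ℚ * x ≡ 1ℚ * (x + 0ℚ)
    last = solve-∀ ℚ-ring
  mul[1+X]-reflect (suc i) (suc j) eq = trans
    (cong₂ _+_ (reflect pal (suc i) j eq′) (reflect pal i (suc j) (ℕ.suc-injective eq)))
    (swap (c j) (c (suc j)))
    where
    eq′ : suc i ℕ.+ j ≡ d
    eq′ = ℕ.suc-injective (trans (cong suc (sym (ℕ.+-suc i j))) eq)
    swap : ∀ x y → 1ℚ * x + 1ℚ * y ≡ 1ℚ * (y + x)
    swap = solve-∀ ℚ-ring

[1+X]^-palindromic : ∀ j → Palindromic 1ℚ j ([1+X]^ j)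
[1+X]^-palindromic zero    = palindromic δ-upper λ { zero zero refl → refl }
[1+X]^-palindromic (suc j) = mul[1+X]-palindromic ([1+X]^-palindromic j)

X^[1+X]^-palindromic : ∀ i j → Palindromic 1ℚ (2 ℕ.* i ℕ.+ j) (X^ i [1+X]^ j)
X^[1+X]^-palindromic zero    j = [1+X]^-palindromic j
X^[1+X]^-palindromic (suc i) j = subst (λ d → Palindromic 1ℚ d (X^ suc i [1+X]^ j)) (sym (2*suc+ i j))
  (mulX-palindromic (X^[1+X]^-palindromic i j))

X^[1+X]^-lowest : ∀ i j → (X^ i [1+X]^ j) i ≡ 1ℚ
X^[1+X]^-lowest zero    zero    = refl
X^[1+X]^-lowest zero    (suc j) = trans (+-identityʳ _) (X^[1+X]^-lowest zero j)
X^[1+X]^-lowest (suc i) j       = X^[1+X]^-lowest i j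

M-row : ∀ {N} i j → M N i j ≡ row (toℕ i) (toℕ j)
M-row i j = cong (_* ½ ^ ⌊ toℕ j /2⌋) (trans
  (ρ-palindromic d P
    -- The coefficient of x^i is 1, so the polynomial is nonzero and its index meaningful.
    (λ P≗0 → 1≢0 (trans (sym (X^[1+X]^-lowest (toℕ i) (toℕ j))) (trans (sym (P≗ (toℕ i))) (IsZero⇒coeff P≗0 (toℕ i)))))
    (Palindromic-resp-≗ (λ k → sym (P≗ k)) (X^[1+X]^-palindromic (toℕ i) (toℕ j))))
  (R-cong d P≗))
  where
  d : ℕ
  d = 2 ℕ.* toℕ i ℕ.+ toℕ j
  P : Poly
  P = X ^ᵖ toℕ i *ᵖ (oneᵖ +ᵖ X) ^ᵖ toℕ j
  P≗ : coeff P ≗ X^ toℕ i [1+X]^ toℕ j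
  P≗ = coeff-X^[1+X]^ (toℕ i) (toℕ j)

-- Closed forms

module ℕ-Solver = +-*-Solver
open ℕ-Solver using () renaming (_:*_ to _ℕ:*_; _:^_ to _ℕ:^_; _:=_ to _ℕ:=_)

suc-C-2 : ∀ n → suc n C 2 ≡ n ℕ.+ n C 2
suc-C-2 n = trans (sym (nCk+nC[k+1]≡[n+1]C[k+1] n 1)) (cong (ℕ._+ n C 2) (nC1≡n n))

½^suc-C-2 : ∀ n → ½ ^ (suc n C 2) ≡ ½ ^ n * ½ ^ (n C 2)
½^suc-C-2 n = trans (cong (½ ^_) (suc-C-2 n)) (^-homo-* ½ n (n C 2))

∏-½ : ∀ n → ∏ n (λ i → ∏ i (λ _ → ½ * 1ℚ)) ≡ ½ ^ (n C 2)
∏-½ zero    = refl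
∏-½ (suc n) = begin
  ∏ (suc n) (λ i → ∏ i (λ _ → ½ * 1ℚ))                  ≡⟨ ∏-snoc n (λ i → ∏ i (λ _ → ½ * 1ℚ)) ⟩
  ∏ n (λ i → ∏ i (λ _ → ½ * 1ℚ)) * ∏ n (λ _ → ½ * 1ℚ)   ≡⟨ cong₂ _*_ (∏-½ n) (∏-constant n) ⟩
  ½ ^ (n C 2) * ½ ^ n                                   ≡⟨ *-comm (½ ^ (n C 2)) (½ ^ n) ⟩
  ½ ^ n * ½ ^ (n C 2)                                   ≡⟨ ½^suc-C-2 n ⟨
  ½ ^ (suc n C 2)                                       ∎
  where
  ∏-constant : ∀ n → ∏ n (λ _ → ½ * 1ℚ) ≡ ½ ^ n
  ∏-constant zero    = refl
  ∏-constant (suc n) = cong (½ *_) (∏-constant n)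

det-M : ∀ N → det (M N) ≡ ½ ^ (N C 2) * dilatedHankel N (1+x ÷ˢ cos)
det-M N = begin
  det (M N)
    ≡⟨ det-cong (M N) (λ i j → row (toℕ i) (toℕ j)) M-row ⟩
  det {N} (λ i j → row (toℕ i) (toℕ j))
    ≡⟨ det-row N ⟩
  ∏ N (λ i → ∏ i (λ _ → ½ * 1ℚ)) * dilatedHankel N (1+x ÷ˢ cos)
    ≡⟨ cong (_* dilatedHankel N (1+x ÷ˢ cos)) (∏-½ N) ⟩
  ½ ^ (N C 2) * dilatedHankel N (1+x ÷ˢ cos) ∎

ν≡fromℕ : ∀ n → ν n 0 ≡ fromℕ n
ν≡fromℕ zero    = refl
ν≡fromℕ (suc n) = trans (cong (1ℚ +_) (ν≡fromℕ n)) (sym (fromℕ-+ 1 n))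

∏-ν : ∀ n → ∏ n (λ k → ν (suc k) 0) ≡ fromℕ (n !)
∏-ν zero    = refl
∏-ν (suc n) = begin
  ∏ (suc n) (λ k → ν (suc k) 0)              ≡⟨ ∏-snoc n (λ k → ν (suc k) 0) ⟩
  ∏ n (λ k → ν (suc k) 0) * ν (suc n) 0      ≡⟨ cong₂ _*_ (∏-ν n) (ν≡fromℕ (suc n)) ⟩
  fromℕ (n !) * fromℕ (suc n)                ≡⟨ *-comm (fromℕ (n !)) (fromℕ (suc n)) ⟩
  fromℕ (suc n) * fromℕ (n !)                ≡⟨ fromℕ-* (suc n) (n !) ⟨
  fromℕ (suc n !)                            ∎

-- The pivots are 2 (k+1), so one ½ for each of them leaves a factorial.
∏-pivot : ∀ n → ½ ^ n * ∏ n (λ k → 1ℚ * pivot k) ≡ fromℕ (n !)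
∏-pivot n = trans (halve n) (∏-ν n)
  where
  halve : ∀ n → ½ ^ n * ∏ n (λ k → 1ℚ * pivot k) ≡ ∏ n (λ k → ν (suc k) 0)
  halve zero    = refl
  halve (suc n) = begin
    ½ * ½ ^ n * ∏ (suc n) (λ k → 1ℚ * pivot k)
      ≡⟨ cong (½ * ½ ^ n *_) (∏-snoc n (λ k → 1ℚ * pivot k)) ⟩
    ½ * ½ ^ n * (∏ n (λ k → 1ℚ * pivot k) * (1ℚ * pivot n))
      ≡⟨ regroup (½ ^ n) (∏ n (λ k → 1ℚ * pivot k)) (ν (suc n) 0) ⟩
    ½ ^ n * ∏ n (λ k → 1ℚ * pivot k) * ν (suc n) 0
      ≡⟨ cong (_* ν (suc n) 0) (halve n) ⟩
    ∏ n (λ k → ν (suc k) 0) * ν (suc n) 0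
      ≡⟨ ∏-snoc n (λ k → ν (suc k) 0) ⟨
    ∏ (suc n) (λ k → ν (suc k) 0) ∎
    where
    regroup : ∀ h p v → ½ * h * (p * (1ℚ * (v + v))) ≡ h * p * v
    regroup = solve-∀ ℚ-ring

-- At 0 the recurrence advances in steps of two, from the value 1 of both `y 1` and `y 2`.
y-at-0 : ∀ n → y (suc n) 0 ≡ fromℕ (n !! ℕ.* n !!)
y-at-0 zero          = refl
y-at-0 (suc zero)    = refl
y-at-0 (suc (suc n)) = begin
  c * 0ℚ * y (suc (suc n)) 0 + ν (suc (suc n)) 0 * ν (suc (suc n)) 0 * y (suc n) 0
    ≡⟨ drop c (y (suc (suc n)) 0) (ν (suc (suc n)) 0 * ν (suc (suc n)) 0 * y (suc n) 0) ⟩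
  ν (suc (suc n)) 0 * ν (suc (suc n)) 0 * y (suc n) 0
    ≡⟨ cong₂ _*_ (cong₂ _*_ (ν≡fromℕ m) (ν≡fromℕ m)) (y-at-0 n) ⟩
  fromℕ m * fromℕ m * fromℕ (n !! ℕ.* n !!)
    ≡⟨ cong (_* fromℕ (n !! ℕ.* n !!)) (fromℕ-* m m) ⟨
  fromℕ (m ℕ.* m) * fromℕ (n !! ℕ.* n !!)
    ≡⟨ fromℕ-* (m ℕ.* m) (n !! ℕ.* n !!) ⟨
  fromℕ (m ℕ.* m ℕ.* (n !! ℕ.* n !!))
    ≡⟨ cong fromℕ (regroup m (n !!)) ⟩
  fromℕ (m !! ℕ.* m !!) ∎
  where
  m : ℕ
  m = suc (suc n)
  c : ℚ
  c = 1ℚ + ν (suc (suc n)) 0 + ν (suc (suc n)) 0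
  drop : ∀ c x z → c * 0ℚ * x + z ≡ z
  drop = solve-∀ ℚ-ring
  regroup : ∀ m d → m ℕ.* m ℕ.* (d ℕ.* d) ≡ m ℕ.* d ℕ.* (m ℕ.* d)
  regroup = ℕ-solve-∀

!!-! : ∀ n → suc n !! ℕ.* n !! ≡ suc n !
!!-! zero    = refl
!!-! (suc n) = trans (regroup (suc (suc n)) (n !!) (suc n !!)) (cong (suc (suc n) ℕ.*_) (!!-! n))
  where
  regroup : ∀ m a b → m ℕ.* a ℕ.* b ≡ m ℕ.* (b ℕ.* a)
  regroup = ℕ-solve-∀

product-snoc : ∀ (f : ℕ → ℕ) n → product (applyUpTo f (suc n)) ≡ product (applyUpTo f n) ℕ.* f n
product-snoc f zero    = ℕ.*-comm (f 0) 1
product-snoc f (suc n) = trans (cong (f 0 ℕ.*_) (product-snoc (f ∘ suc) n)) (sym (ℕ.*-assoc (f 0) _ (f (suc n))))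

hankelValue : ℕ → ℕ
hankelValue n = (n !!) ℕ.^ 2 ℕ.* ∏₁ (n ∸ 1) (λ k → (k !!) ℕ.^ 6)

-- The ratio equals ((n+1)!)² (n!!)², the contribution of one more row to the triangular
-- factorisation.
hankelValue-suc : ∀ n → hankelValue (suc n) ≡ hankelValue n ℕ.* ((suc n !!) ℕ.^ 2 ℕ.* (n !!) ℕ.^ 4)
hankelValue-suc zero    = refl
hankelValue-suc (suc n) = trans
  (cong ((suc (suc n) !!) ℕ.^ 2 ℕ.*_) (product-snoc (λ k → (suc k !!) ℕ.^ 6) n))
  (regroup (suc (suc n) !!) (∏₁ n (λ k → (k !!) ℕ.^ 6)) (suc n !!))
  where
  regroup : ∀ a p b → a ℕ.^ 2 ℕ.* (p ℕ.* b ℕ.^ 6) ≡ b ℕ.^ 2 ℕ.* p ℕ.* (a ℕ.^ 2 ℕ.* b ℕ.^ 4)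
  regroup = ℕ-Solver.solve 3 (λ a p b → a ℕ:^ 2 ℕ:* (p ℕ:* b ℕ:^ 6) ℕ:= b ℕ:^ 2 ℕ:* p ℕ:* (a ℕ:^ 2 ℕ:* b ℕ:^ 4)) refl

-- Steps of two, after the period of `ε`: consecutive ratios b² c⁴ and a² b⁴ multiply to (ab)²
-- (bc)⁴, which are the factors k = 1 and k = 2.
hankelValue-factorials : ∀ n → hankelValue n ≡ ∏₁ n (λ k → ((suc n ∸ k) !) ℕ.^ ε k)
hankelValue-factorials zero          = refl
hankelValue-factorials (suc zero)    = refl
hankelValue-factorials (suc (suc n)) = begin
  hankelValue (suc (suc n))
    ≡⟨ hankelValue-suc (suc n) ⟩
  hankelValue (suc n) ℕ.* (a ℕ.^ 2 ℕ.* b ℕ.^ 4)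
    ≡⟨ cong (ℕ._* (a ℕ.^ 2 ℕ.* b ℕ.^ 4)) (hankelValue-suc n) ⟩
  hankelValue n ℕ.* (b ℕ.^ 2 ℕ.* c ℕ.^ 4) ℕ.* (a ℕ.^ 2 ℕ.* b ℕ.^ 4)
    ≡⟨ regroup (hankelValue n) a b c ⟩
  (a ℕ.* b) ℕ.^ 2 ℕ.* ((b ℕ.* c) ℕ.^ 4 ℕ.* hankelValue n)
    ≡⟨ cong₂ (λ u v → u ℕ.^ 2 ℕ.* v) (!!-! (suc n)) (cong₂ (λ u v → u ℕ.^ 4 ℕ.* v) (!!-! n) (hankelValue-factorials n)) ⟩
  (suc (suc n) !) ℕ.^ 2 ℕ.* ((suc n !) ℕ.^ 4 ℕ.* ∏₁ n (λ k → ((suc n ∸ k) !) ℕ.^ ε k)) ∎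
  where
  a b c : ℕ
  a = suc (suc n) !!
  b = suc n !!
  c = n !!
  regroup : ∀ g a b c → g ℕ.* (b ℕ.^ 2 ℕ.* c ℕ.^ 4) ℕ.* (a ℕ.^ 2 ℕ.* b ℕ.^ 4) ≡ (a ℕ.* b) ℕ.^ 2 ℕ.* ((b ℕ.* c) ℕ.^ 4 ℕ.* g)
  regroup = ℕ-Solver.solve 4 (λ g a b c → g ℕ:* (b ℕ:^ 2 ℕ:* c ℕ:^ 4) ℕ:* (a ℕ:^ 2 ℕ:* b ℕ:^ 4) ℕ:= (a ℕ:* b) ℕ:^ 2 ℕ:* ((b ℕ:* c) ℕ:^ 4 ℕ:* g)) refl

hankel-value : ∀ n → ½ ^ (suc n C 2) * dilatedHankel (suc n) (1+x ÷ˢ cos) ≡ fromℕ (hankelValue n)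
hankel-value n = trans (cong (½ ^ (suc n C 2) *_) (det-hankel (suc n))) (go n)
  where
  A B : ℕ → ℚ
  A i = ∏ i (λ k → 1ℚ * pivot k)
  B i = ∏ i (λ k → ν (suc k) 0) * (secᴴ 0 * y i 0)
  factor : ∀ n → ½ ^ suc n * A (suc n) * B (suc n) ≡ fromℕ ((suc n !!) ℕ.^ 2 ℕ.* (n !!) ℕ.^ 4)
  factor n = begin
    ½ ^ suc n * A (suc n) * B (suc n)
      -- `*-identityˡ` applies because sec 0 computes to 1.
      ≡⟨ cong₂ _*_ (∏-pivot (suc n)) (cong₂ _*_ (∏-ν (suc n)) (trans (*-identityˡ (y (suc n) 0)) (y-at-0 n))) ⟩
    fromℕ (suc n !) * (fromℕ (suc n !) * fromℕ (n !! ℕ.* n !!))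
      ≡⟨ trans (fromℕ-* (suc n !) _) (cong (fromℕ (suc n !) *_) (fromℕ-* (suc n !) (n !! ℕ.* n !!))) ⟨
    fromℕ (suc n ! ℕ.* (suc n ! ℕ.* (n !! ℕ.* n !!)))
      ≡⟨ cong fromℕ (trans (cong (λ u → u ℕ.* (u ℕ.* (n !! ℕ.* n !!))) (sym (!!-! n))) (regroup (suc n !!) (n !!))) ⟩
    fromℕ ((suc n !!) ℕ.^ 2 ℕ.* (n !!) ℕ.^ 4) ∎
    where
    regroup : ∀ a b → a ℕ.* b ℕ.* (a ℕ.* b ℕ.* (b ℕ.* b)) ≡ a ℕ.^ 2 ℕ.* b ℕ.^ 4
    regroup = ℕ-Solver.solve 2 (λ a b → a ℕ:* b ℕ:* (a ℕ:* b ℕ:* (b ℕ:* b)) ℕ:= a ℕ:^ 2 ℕ:* b ℕ:^ 4) refl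
  go : ∀ n → ½ ^ (suc n C 2) * (∏ (suc n) A * ∏ (suc n) B) ≡ fromℕ (hankelValue n)
  go zero    = refl
  go (suc n) = begin
    ½ ^ (suc m C 2) * (∏ (suc m) A * ∏ (suc m) B)
      ≡⟨ cong₂ _*_ (½^suc-C-2 m) (cong₂ _*_ (∏-snoc m A) (∏-snoc m B)) ⟩
    ½ ^ m * ½ ^ (m C 2) * (∏ m A * A m * (∏ m B * B m))
      ≡⟨ regroup (½ ^ m) (½ ^ (m C 2)) (∏ m A) (A m) (∏ m B) (B m) ⟩
    ½ ^ (m C 2) * (∏ m A * ∏ m B) * (½ ^ m * A m * B m)
      ≡⟨ cong₂ _*_ (go n) (factor n) ⟩
    fromℕ (hankelValue n) * fromℕ ((m !!) ℕ.^ 2 ℕ.* (n !!) ℕ.^ 4)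
      ≡⟨ fromℕ-* (hankelValue n) ((m !!) ℕ.^ 2 ℕ.* (n !!) ℕ.^ 4) ⟨
    fromℕ (hankelValue n ℕ.* ((m !!) ℕ.^ 2 ℕ.* (n !!) ℕ.^ 4))
      ≡⟨ cong fromℕ (hankelValue-suc n) ⟨
    fromℕ (hankelValue m) ∎
    where
    m : ℕ
    m = suc n
    regroup : ∀ h k a x b z → h * k * (a * x * (b * z)) ≡ k * (a * b) * (h * x * z)
    regroup = solve-∀ ℚ-ring

theorem26p1 : ∀ (N : ℕ) → 1 ≤ N →
    (det (M N) ≡ ½ ^ (N C 2) * dilatedHankel N (1+x ÷ˢ cos))
    × (½ ^ (N C 2) * dilatedHankel N (1+x ÷ˢ cos)
    ≡ fromℕ (((N ∸ 1) !!) ℕ.^ 2 ℕ.* ∏₁ (N ∸ 2) (λ k → (k !!) ℕ.^ 6)))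
    × (fromℕ (((N ∸ 1) !!) ℕ.^ 2 ℕ.* ∏₁ (N ∸ 2) (λ k → (k !!) ℕ.^ 6))
    ≡ fromℕ (∏₁ (N ∸ 1) (λ k → ((N ∸ k) !) ℕ.^ ε k)))
theorem26p1 (suc n) _ = det-M (suc n) , hankel-value n , cong fromℕ (hankelValue-factorials n)
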